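{- Let $G=(V,E)$ be a finite simple graph and let $\chi_G(x,y)$ be its bivariate chromatic polynomial. Then for all integers $x \ge 1$ and $0 \le y \le x$, \[ \chi_G(-x,-y) \;=\; \sum_{H \text{ flat of } G} (-1)^{|V(H)|}\, m_H(\sigma,c), \] where $m_H(\sigma,c)$ denotes the number of pairs $(\sigma,c)$ consisting of an acyclic orientation $\sigma$ of $H$ and a coloring $c : V(H) \to [x]$ compatible with $\sigma$ such that $c(v) > y$ for every $v \in C(H)$.
   Context: For a positive integer $x$, $[x]=\{1,\dots,x\}$. For integers $x\ge 1$, $0 \le y \le x$, $\chi_G(x,y)$ is the number of colorings $c : V \to [x]$ such that for every edge $vw \in E$, either $c(v) \ne c(w)$ or $c(v)=c(w) > y$. This counting function is given by a polynomial in $x$ and $y$, the bivariate chromatic polynomial, and $\chi_G(-x,-y)$ denotes the evaluation of this polynomial at $(-x,-y)$. A flat of $G$ is a graph $H$ that can be constructed from $G$ by a (possibly empty) series of edge contractions. Flats are identified by the vertex partition they induce: flats $H$ of $G$ correspond bijectively to partitions of $V$ into nonempty blocks each inducing a connected subgraph of $G$; the vertex set $V(H)$ is the set of blocks, and two distinct blocks are adjacent in $H$ iff some edge of $G$ joins them (no loops, parallel edges merged). $C(H) \subseteq V(H)$ is the set of vertices of $H$ that resulted from contractions, i.e. the blocks with at least two elements. An orientation $\sigma$ of $H$ and a coloring $c: V(H)\to[x]$ are compatible if $c(v) \le c(w)$ for every edge of $H$ oriented from $v$ to $w$. An orientation is acyclic if it has no directed cycle. -}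

module Defs where

open import Data.Fin using (Fin; toℕ; _≟_)
open import Data.Fin.Properties using (all?; any?)
open import Data.Fin.Subset using (Subset; inside; outside; _∈_; Nonempty; ∣_∣)
open import Data.Fin.Subset.Properties using (_∈?_; nonempty?)
open import Data.Integer using (ℤ; +_; 0ℤ) renaming (_+_ to _+ℤ_; _*_ to _*ℤ_)
open import Data.List using (List; []; _∷_; _++_; map; foldr; filter; length; lookup; allFin;
  cartesianProduct; cartesianProductWith)
open import Data.List.Membership.Propositional using () renaming (_∈_ to _∈ˡ_)
open import Data.List.Membership.Propositional.Properties using (∈-allFin)
open import Data.List.Relation.Unary.All using (All) renaming (all? to allˡ?)
open import Data.List.Relation.Unary.Any using (here; there)
open import Data.Nat using (ℕ; zero; suc; _≤_; _<_; _≤?_; _<?_) renaming (_≟_ to _≟ℕ_)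
open import Data.Product using (_×_; _,_; ∃₂; ∃!)
open import Data.Sum using (_⊎_; inj₁; inj₂)
open import Data.Vec using (Vec; []; _∷_) renaming (lookup to lookupᵛ)
open import Level using (0ℓ)
open import Relation.Binary using (Rel; Decidable; Symmetric; Irreflexive)
open import Relation.Binary.Construct.Closure.ReflexiveTransitive using (Star; ε; _◅_)
open import Relation.Binary.Construct.Closure.Transitive using (TransClosure; [_]) renaming (_∷_ to _∷⁺_; _++_ to _++⁺_)
open import Relation.Binary.PropositionalEquality using (_≡_; _≢_; refl; sym)
open import Relation.Nullary using (Dec; ¬_)
open import Relation.Nullary.Decidable using (map′; ¬?; _×-dec_; _⊎-dec_; _→-dec_)
open import Relation.Unary using (Pred) renaming (Decidable to Decidable₁)

vectors : {A : Set} → List A → (n : ℕ) → List (Vec A n)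
vectors xs zero    = [] ∷ []
vectors xs (suc n) = cartesianProductWith _∷_ xs (vectors xs n)

subsets : (n : ℕ) → List (Subset n)
subsets = vectors (inside ∷ outside ∷ [])

sublists : {A : Set} → List A → List (List A)
sublists []       = [] ∷ []
sublists (x ∷ xs) = map (x ∷_) (sublists xs) ++ sublists xs

count : {A : Set} {P : Pred A 0ℓ} → Decidable₁ P → List A → ℕ
count P? xs = length (filter P? xs)

sumℤ : {A : Set} → List A → (A → ℤ) → ℤ
sumℤ xs f = foldr _+ℤ_ 0ℤ (map f xs)

∃!? : ∀ {n} {P : Pred (Fin n) 0ℓ} → Decidable₁ P → Dec (∃! _≡_ P)
∃!? P? = map′
  (λ (i , p , u) → i , p , λ {j} → u j)
  (λ (i , p , u) → i , p , λ j → u {j})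
  (any? λ i → P? i ×-dec all? λ j → P? j →-dec (i ≟ j))

module Reachability {n : ℕ} {R : Rel (Fin n) 0ℓ} (R? : Decidable R) where

  -- Nonempty walks whose intermediate vertices lie in the list (Warshall).
  Via : List (Fin n) → Rel (Fin n) 0ℓ
  Via []       u v = R u v
  Via (w ∷ ws) u v = Via ws u v ⊎ (Via ws u w × Via ws w v)

  via? : ∀ ws → Decidable (Via ws)
  via? []       u v = R? u v
  via? (w ∷ ws) u v = via? ws u v ⊎-dec (via? ws u w ×-dec via? ws w v)

  base : ∀ ws {u v} → R u v → Via ws u v
  base []       r = r
  base (w ∷ ws) r = inj₁ (base ws r)

  sound : ∀ ws {u v} → Via ws u v → TransClosure R u v
  sound []       r              = [ r ]
  sound (w ∷ ws) (inj₁ p)       = sound ws p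
  sound (w ∷ ws) (inj₂ (p , q)) = sound ws p ++⁺ sound ws q

  join : ∀ {ws u w v} → w ∈ˡ ws → Via ws u w → Via ws w v → Via ws u v
  join {w ∷ ws} (here refl) p q = inj₂ (toHead p , fromHead q)
    where
    toHead : ∀ {u} → Via (w ∷ ws) u w → Via ws u w
    toHead (inj₁ p)       = p
    toHead (inj₂ (p , _)) = p
    fromHead : ∀ {v} → Via (w ∷ ws) w v → Via ws w v
    fromHead (inj₁ q)       = q
    fromHead (inj₂ (_ , q)) = q
  join {_ ∷ _} (there i) (inj₁ p)        (inj₁ q)        = inj₁ (join i p q)
  join {_ ∷ _} (there i) (inj₁ p)        (inj₂ (q , q′)) = inj₂ (join i p q , q′)
  join {_ ∷ _} (there i) (inj₂ (p , p′)) (inj₁ q)        = inj₂ (p , join i p′ q)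
  join {_ ∷ _} (there i) (inj₂ (p , _))  (inj₂ (_ , q′)) = inj₂ (p , q′)

  complete : ∀ {u v} → TransClosure R u v → Via (allFin n) u v
  complete [ r ]    = base (allFin n) r
  complete (r ∷⁺ p) = join (∈-allFin _) (base (allFin n) r) (complete p)

  transClosure? : Decidable (TransClosure R)
  transClosure? u v = map′ (sound (allFin n)) complete (via? (allFin n) u v)

  star? : Decidable (Star R)
  star? u v = map′ to from ((u ≟ v) ⊎-dec transClosure? u v)
    where
    to⁺ : ∀ {u v} → TransClosure R u v → Star R u v
    to⁺ [ r ]    = r ◅ ε
    to⁺ (r ∷⁺ p) = r ◅ to⁺ p
    to : ∀ {u v} → u ≡ v ⊎ TransClosure R u v → Star R u v
    to (inj₁ refl) = ε
    to (inj₂ p)    = to⁺ p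
    from : ∀ {u v} → Star R u v → u ≡ v ⊎ TransClosure R u v
    from ε       = inj₁ refl
    from (r ◅ s) with from s
    ... | inj₁ refl = inj₂ [ r ]
    ... | inj₂ p    = inj₂ (r ∷⁺ p)

open Reachability using (transClosure?; star?)

record Graph (n : ℕ) : Set₁ where
  field
    Adj    : Rel (Fin n) 0ℓ
    adj?   : Decidable Adj
    symm   : Symmetric Adj
    irrefl : Irreflexive _≡_ Adj

open Graph public

Coloring : ℕ → ℕ → Set
Coloring x n = Vec (Fin x) n

colorings : (x n : ℕ) → List (Coloring x n)
colorings x n = vectors (allFin x) n

color : ∀ {x n} → Coloring x n → Fin n → ℕ
color c v = suc (toℕ (lookupᵛ c v))

Admissible : ∀ {n} → Graph n → (x y : ℕ) → Coloring x n → Set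
Admissible G x y c = ∀ v w → Adj G v w →
  color c v ≢ color c w ⊎ (color c v ≡ color c w × y < color c v)

admissible? : ∀ {n} (G : Graph n) (x y : ℕ) → Decidable₁ (Admissible G x y)
admissible? G x y c = all? λ v → all? λ w → adj? G v w →-dec
  (¬? (color c v ≟ℕ color c w) ⊎-dec ((color c v ≟ℕ color c w) ×-dec (y <? color c v)))

countAdmissible : ∀ {n} → Graph n → (x y : ℕ) → ℕ
countAdmissible {n} G x y = count (admissible? G x y) (colorings x n)

-- Coefficient lists: the entry j of the entry i is the coefficient of xⁱ yʲ.
-- Polynomials with integer coefficients suffice: inclusion–exclusion over the
-- edges writes the coloring count as a signed sum of monomials.
Polynomial₂ : Set
Polynomial₂ = List (List ℤ)

eval₁ : List ℤ → ℤ → ℤ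
eval₁ p y = foldr (λ a r → a +ℤ y *ℤ r) 0ℤ p

eval₂ : Polynomial₂ → ℤ → ℤ → ℤ
eval₂ p x y = foldr (λ q r → eval₁ q y +ℤ x *ℤ r) 0ℤ p

-- The infinitely many points (x , y) below determine the polynomial, so this
-- record has essentially one inhabitant.
record BivariateChromaticPolynomial {n : ℕ} (G : Graph n) : Set where
  field
    polynomial : Polynomial₂
    counts     : ∀ x y → 1 ≤ x → y ≤ x →
                 eval₂ polynomial (+ x) (+ y) ≡ + countAdmissible G x y

  _⟨_,_⟩ : ℤ → ℤ → ℤ
  _⟨_,_⟩ x y = eval₂ polynomial x y

open BivariateChromaticPolynomial public

-- A list of blocks stands for a set of blocks: the lists considered below are
-- sublists of the repetition-free enumeration of all subsets.
IsPartition : ∀ {n} → List (Subset n) → Set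
IsPartition Bs = All Nonempty Bs × (∀ v → ∃! _≡_ λ i → v ∈ lookup Bs i)

isPartition? : ∀ {n} → Decidable₁ (IsPartition {n})
isPartition? Bs = allˡ? nonempty? Bs ×-dec all? λ v → ∃!? λ i → v ∈? lookup Bs i

module _ {n : ℕ} (G : Graph n) where

  AdjWithin : Subset n → Rel (Fin n) 0ℓ
  AdjWithin B u v = u ∈ B × v ∈ B × Adj G u v

  Connected : Subset n → Set
  Connected B = ∀ u v → u ∈ B → v ∈ B → Star (AdjWithin B) u v

  connected? : Decidable₁ Connected
  connected? B = all? λ u → all? λ v → (u ∈? B) →-dec ((v ∈? B) →-dec
    star? (λ u v → (u ∈? B) ×-dec ((v ∈? B) ×-dec adj? G u v)) u v)

  -- A flat is identified with the partition of V into the vertex sets that its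
  -- contractions merge; these are exactly the partitions into connected blocks.
  IsFlat : List (Subset n) → Set
  IsFlat Bs = IsPartition Bs × All Connected Bs

  isFlat? : Decidable₁ IsFlat
  isFlat? Bs = isPartition? Bs ×-dec allˡ? connected? Bs

  flats : List (List (Subset n))
  flats = filter isFlat? (sublists (subsets n))

  flatGraph : (Bs : List (Subset n)) → Graph (length Bs)
  flatGraph Bs = record
    { Adj    = λ i j → i ≢ j × ∃₂ λ u v → u ∈ lookup Bs i × v ∈ lookup Bs j × Adj G u v
    ; adj?   = λ i j → ¬? (i ≟ j) ×-dec any? λ u → any? λ v →
                 (u ∈? lookup Bs i) ×-dec ((v ∈? lookup Bs j) ×-dec adj? G u v)
    ; symm   = λ (i≢j , u , v , u∈ , v∈ , uv) →
                 (λ j≡i → i≢j (sym j≡i)) , v , u , v∈ , u∈ , symm G uv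
    ; irrefl = λ i≡j (i≢j , _) → i≢j i≡j
    }

-- A vertex results from a contraction iff its block is not a singleton.
Contracted : ∀ {n} (Bs : List (Subset n)) → Fin (length Bs) → Set
Contracted Bs i = 2 ≤ ∣ lookup Bs i ∣

contracted? : ∀ {n} (Bs : List (Subset n)) → Decidable₁ (Contracted Bs)
contracted? Bs i = 2 ≤? ∣ lookup Bs i ∣

-- The set of out-neighbours of each vertex.
Orientation : ℕ → Set
Orientation k = Vec (Subset k) k

Arc : ∀ {k} → Orientation k → Rel (Fin k) 0ℓ
Arc σ v w = w ∈ lookupᵛ σ v

arc? : ∀ {k} (σ : Orientation k) → Decidable (Arc σ)
arc? σ v w = w ∈? lookupᵛ σ v

IsOrientation : ∀ {k} → Graph k → Orientation k → Set
IsOrientation H σ =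
    (∀ v w → Arc σ v w → Adj H v w)
  × (∀ v w → Adj H v w → (Arc σ v w × ¬ Arc σ w v) ⊎ (Arc σ w v × ¬ Arc σ v w))

isOrientation? : ∀ {k} (H : Graph k) → Decidable₁ (IsOrientation H)
isOrientation? H σ =
  (all? λ v → all? λ w → arc? σ v w →-dec adj? H v w) ×-dec
  (all? λ v → all? λ w → adj? H v w →-dec
    ((arc? σ v w ×-dec ¬? (arc? σ w v)) ⊎-dec (arc? σ w v ×-dec ¬? (arc? σ v w))))

Acyclic : ∀ {k} → Orientation k → Set
Acyclic σ = ∀ v → ¬ TransClosure (Arc σ) v v

acyclic? : ∀ {k} → Decidable₁ (Acyclic {k})
acyclic? σ = all? λ v → ¬? (transClosure? (arc? σ) v v)

acyclicOrientations : ∀ {k} → Graph k → List (Orientation k)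
acyclicOrientations {k} H =
  filter (λ σ → isOrientation? H σ ×-dec acyclic? σ) (vectors (subsets k) k)

Compatible : ∀ {x k} → Orientation k → Coloring x k → Set
Compatible σ c = ∀ v w → Arc σ v w → color c v ≤ color c w

compatible? : ∀ {x k} (σ : Orientation k) → Decidable₁ (Compatible {x} σ)
compatible? σ c = all? λ v → all? λ w → arc? σ v w →-dec (color c v ≤? color c w)

module _ {n x : ℕ} (y : ℕ) (Bs : List (Subset n)) where

  ValidPair : Orientation (length Bs) × Coloring x (length Bs) → Set
  ValidPair (σ , c) = Compatible σ c × (∀ v → Contracted Bs v → y < color c v)

  validPair? : Decidable₁ ValidPair
  validPair? (σ , c) =
    compatible? σ c ×-dec all? λ v → contracted? Bs v →-dec (y <? color c v)

m : ∀ {n} → Graph n → (x y : ℕ) → List (Subset n) → ℕ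
m G x y Bs = count (validPair? y Bs)
  (cartesianProduct (acyclicOrientations (flatGraph G Bs)) (colorings x (length Bs)))

{-# OPTIONS --safe #-}
module Submission where

-- Put z = x − y. Contracting the monochromatic edges of an admissible coloring
-- gives a proper coloring of a unique flat H with colors above y on C(H), and
-- this is strictly increasing along a unique acyclic orientation σ of H. Adding
-- the color classes one at a time, the colorings of H strictly increasing along
-- σ are counted by a value of Lʸ · Sᶻ in the incidence algebra of the Boolean
-- lattice on V(H), where S(I , J) ∈ {0 , 1} tests whether J ∖ I may follow I as a
-- color class and L moreover forbids the vertices of C(H). As σ is acyclic, the
-- inverse of S is (−1)^|J ∖ I| times the corresponding kernel of weakly
-- increasing colorings, and Sᶻ is polynomial in z because S is unipotent; the
-- same holds for L. So negating y and z turns strictly into weakly increasing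
-- colorings, with the sign (−1)^|V(H)|.

open import Defs
open import Data.Integer using (+_; -_; -1ℤ; _*_; _^_)
open import Data.List using (length)
open import Data.Nat using (ℕ; _≤_)
open import Relation.Binary.PropositionalEquality using (_≡_)

open import Data.Bool using (Bool; true; false; T; if_then_else_)
import Data.Bool as Bool
open import Data.Bool.Properties using (T?)
open import Data.Fin using (Fin; zero; suc; toℕ; _≟_)
open import Data.Fin.Induction using (spo-wellFounded)
open import Data.Fin.Properties using (all?; any?; toℕ-injective)
open import Data.Fin.Subset using (Subset; _∈_; ∣_∣; ⁅_⁆; Nonempty)
open import Data.Fin.Subset.Properties using (⊆-antisym; _∈?_; ∣⁅x⁆∣≡1; p⊆q⇒∣p∣≤∣q∣; p⊂q⇒∣p∣<∣q∣;
  x∈⁅x⁆; x∈⁅y⁆⇒x≡y)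
open import Data.Integer using (ℤ; _+_; _-_; 0ℤ; 1ℤ; -[1+_]) renaming (suc to sucℤ)
open import Data.Integer.Properties using (+-identityˡ; +-identityʳ; +-assoc; +-comm; *-identityˡ;
  *-identityʳ; *-zeroˡ; *-zeroʳ; *-assoc; *-distribˡ-+; *-distribʳ-+; -1*i≡-i; ^-distribˡ-+-*;
  neg-distrib-+; i-j≡0⇒i≡j; i≡j⇒i-j≡0)
open import Data.Integer.Tactic.RingSolver using (solve-∀)
open import Data.List using (List; []; _∷_; _++_; map; filter; lookup; allFin;
  cartesianProduct; cartesianProductWith)
open import Data.List.Membership.Propositional using () renaming (_∈_ to _∈ˡ_)
open import Data.List.Membership.Propositional.Properties using (∈-allFin; ∈-filter⁺; ∈-filter⁻;
  ∈-map⁺; ∈-map⁻; ∈-++⁺ˡ; ∈-++⁺ʳ; ∈-++⁻; ∈-lookup; ∈-cartesianProductWith⁺)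
open import Data.List.Properties using (map-tabulate; filter-accept; filter-reject; ∷-injectiveʳ)
open import Data.List.Relation.Unary.All as All using ([]; _∷_)
open import Data.List.Relation.Unary.AllPairs using ([]; _∷_)
open import Data.List.Relation.Unary.Any using (here; there; index)
open import Data.List.Relation.Unary.Any.Properties using (lookup-index)
open import Data.List.Relation.Unary.Unique.Propositional using (Unique)
open import Data.List.Relation.Unary.Unique.Propositional.Properties using (map⁺; ++⁺; filter⁺;
  allFin⁺; cartesianProductWith⁺; Unique[x∷xs]⇒x∉xs)
open import Data.Nat using (zero; suc; _<_; z≤n; s≤s; _<ᵇ_; _∸_; _<?_; _≤?_)
  renaming (_+_ to _+ℕ_; _≟_ to _≟ℕ_)
import Data.Nat.Properties as ℕₚ
open import Data.Product using (_×_; _,_; proj₁; proj₂; ∃)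
open import Data.Sum using (_⊎_; inj₁; inj₂)
open import Data.Vec using (Vec; []; _∷_; replicate; tabulate; _[_]≔_)
  renaming (lookup to lookupᵛ; map to mapᵛ)
open import Data.Vec.Properties using (lookup∘tabulate; lookup∘update; lookup∘update′; lookup-map;
  lookup⇒[]=; []=⇒lookup; ∷-injective; ≡-dec)
open import Data.Vec.Relation.Binary.Pointwise.Extensional using (ext; Pointwise-≡⇒≡)
open import Function using (_∘_; mk⇔)
open import Induction.WellFounded using (WellFounded; Acc; acc)
open import Level using (0ℓ)
open import Relation.Binary using (Rel; Decidable; tri<; tri≈; tri>)
open import Relation.Binary.Construct.Closure.ReflexiveTransitive using (Star; ε; _◅_; _◅◅_; reverse)
open import Relation.Binary.Construct.Closure.Transitive using (TransClosure; [_])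
  renaming (_∷_ to _∷⁺_; _++_ to _++⁺_)
open import Relation.Binary.PropositionalEquality using (_≢_; _≗_; refl; sym; trans; cong; cong₂;
  subst; ≢-sym; resp₂; isEquivalence; module ≡-Reasoning)
open import Relation.Nullary using (Dec; yes; no; ¬_; contradiction; does)
open import Relation.Nullary.Decidable using (¬?; _×-dec_; _→-dec_; dec-true; dec-false; does-⇔)
open import Relation.Unary using (Pred) renaming (Decidable to Decidable₁)

open Reachability using (star?)

-- The coloring counts are given only where `y ≤ x`. In the coordinates `y` and `z` this region is a
-- full quadrant, so an identity can be extended to all integers in one variable at a time.
-- Polynomiality enters through iterated differences, and no coefficients of the right-hand side are
-- computed. `L` and `S` do not commute in general, and negation acts on the two exponents
-- separately: the negated value is that of `L⁻ʸ · S⁻ᶻ`, with the factors in the old order, unlike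
-- in the inverse of `Lʸ · Sᶻ`. So the colors up to `y` still come before the others, and they are
-- still the ones forbidden on `C(H)`. The inverse of `S` rests on a sign-reversing involution. In
-- the product of `S` with its candidate inverse, a vertex of the interval without in-neighbors in
-- the interval is moved between the two factors; this changes the sign and nothing else. Acyclicity
-- enters through the existence of such a vertex.

private variable
  A B C : Set
  k n x : ℕ

-- Sums and indicators

+-congˡ : ∀ a {b c : ℤ} → b ≡ c → a + b ≡ a + c
+-congˡ a refl = refl

sum-cong : ∀ (xs : List A) {f g : A → ℤ} → (∀ a → a ∈ˡ xs → f a ≡ g a) → sumℤ xs f ≡ sumℤ xs g
sum-cong []       f≗g = refl
sum-cong (x ∷ xs) f≗g = cong₂ _+_ (f≗g x (here refl)) (sum-cong xs λ a a∈ → f≗g a (there a∈))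

sum-zero : ∀ (xs : List A) {f : A → ℤ} → (∀ a → a ∈ˡ xs → f a ≡ 0ℤ) → sumℤ xs f ≡ 0ℤ
sum-zero []       f≗0 = refl
sum-zero (x ∷ xs) f≗0 = cong₂ _+_ (f≗0 x (here refl)) (sum-zero xs λ a a∈ → f≗0 a (there a∈))

+-interchange : ∀ a b c d → (a + b) + (c + d) ≡ (a + c) + (b + d)
+-interchange = solve-∀

sum-+ : ∀ (xs : List A) (f g : A → ℤ) → sumℤ xs (λ a → f a + g a) ≡ sumℤ xs f + sumℤ xs g
sum-+ []       f g = refl
sum-+ (x ∷ xs) f g = trans (+-congˡ (f x + g x) (sum-+ xs f g)) (+-interchange (f x) (g x) _ _)

sum-*ˡ : ∀ (xs : List A) k (f : A → ℤ) → sumℤ xs (λ a → k * f a) ≡ k * sumℤ xs f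
sum-*ˡ []       k f = sym (*-zeroʳ k)
sum-*ˡ (x ∷ xs) k f = trans (+-congˡ (k * f x) (sum-*ˡ xs k f)) (sym (*-distribˡ-+ k (f x) _))

sum-swap : ∀ (xs : List A) (ys : List B) (f : A → B → ℤ) →
  sumℤ xs (λ a → sumℤ ys (f a)) ≡ sumℤ ys (λ b → sumℤ xs (λ a → f a b))
sum-swap []       ys f = sym (sum-zero ys λ _ _ → refl)
sum-swap (x ∷ xs) ys f = trans (+-congˡ (sumℤ ys (f x)) (sum-swap xs ys f)) (sym (sum-+ ys (f x) _))

sum-++ : ∀ (xs ys : List A) (f : A → ℤ) → sumℤ (xs ++ ys) f ≡ sumℤ xs f + sumℤ ys f
sum-++ []       ys f = sym (+-identityˡ _)
sum-++ (x ∷ xs) ys f = trans (+-congˡ (f x) (sum-++ xs ys f)) (sym (+-assoc (f x) _ _))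

sum-map : ∀ (xs : List A) (g : A → B) (f : B → ℤ) → sumℤ (map g xs) f ≡ sumℤ xs (f ∘ g)
sum-map []       g f = refl
sum-map (x ∷ xs) g f = +-congˡ (f (g x)) (sum-map xs g f)

sum-cartesianProductWith : ∀ (h : A → B → C) xs ys (f : C → ℤ) →
  sumℤ (cartesianProductWith h xs ys) f ≡ sumℤ xs (λ a → sumℤ ys (λ b → f (h a b)))
sum-cartesianProductWith h []       ys f = refl
sum-cartesianProductWith h (x ∷ xs) ys f = trans (sum-++ (map (h x) ys) _ f)
  (cong₂ _+_ (sum-map ys (h x) f) (sum-cartesianProductWith h xs ys f))

sum-single : ∀ {xs : List A} {f : A → ℤ} {a} → Unique xs → a ∈ˡ xs →
  (∀ b → b ∈ˡ xs → b ≢ a → f b ≡ 0ℤ) → sumℤ xs f ≡ f a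
sum-single {xs = x ∷ xs} {f} (x∉ ∷ _) (here refl) zeros = trans
  (+-congˡ (f x) (sum-zero xs λ b b∈ → zeros b (there b∈) (≢-sym (All.lookup x∉ b∈))))
  (+-identityʳ (f x))
sum-single {f = f} (x∉ ∷ uniq) (there a∈) zeros = trans
  (cong₂ _+_ (zeros _ (here refl) (All.lookup x∉ a∈)) (sum-single uniq a∈ λ b b∈ → zeros b (there b∈)))
  (+-identityˡ _)

⟦_⟧ : {P : Set} → Dec P → ℤ
⟦ p? ⟧ = if does p? then 1ℤ else 0ℤ

⟦⟧-true : ∀ {P : Set} (p? : Dec P) → P → ⟦ p? ⟧ ≡ 1ℤ
⟦⟧-true p? p = cong (if_then 1ℤ else 0ℤ) (dec-true p? p)

⟦⟧-false : ∀ {P : Set} (p? : Dec P) → ¬ P → ⟦ p? ⟧ ≡ 0ℤ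
⟦⟧-false p? ¬p = cong (if_then 1ℤ else 0ℤ) (dec-false p? ¬p)

⟦⟧-cong : ∀ {P Q : Set} (p? : Dec P) (q? : Dec Q) → (P → Q) → (Q → P) → ⟦ p? ⟧ ≡ ⟦ q? ⟧
⟦⟧-cong p? q? f g = cong (if_then 1ℤ else 0ℤ) (does-⇔ (mk⇔ f g) p? q?)

⟦⟧-case : ∀ {P : Set} (p? : Dec P) {a} → (P → a ≡ 1ℤ) → (¬ P → a ≡ 0ℤ) → a ≡ ⟦ p? ⟧
⟦⟧-case (yes p) one none = one p
⟦⟧-case (no ¬p) one none = none ¬p

⟦⟧-× : ∀ {P Q : Set} (p? : Dec P) (q? : Dec Q) → ⟦ p? ×-dec q? ⟧ ≡ ⟦ p? ⟧ * ⟦ q? ⟧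
⟦⟧-× (yes _) q? = sym (*-identityˡ ⟦ q? ⟧)
⟦⟧-× (no _)  q? = refl

⟦⟧-vanish : ∀ {P : Set} (p? : Dec P) a → (P → a ≡ 0ℤ) → ⟦ p? ⟧ * a ≡ 0ℤ
⟦⟧-vanish (yes p) a zero-if = trans (*-identityˡ a) (zero-if p)
⟦⟧-vanish (no _)  a _       = *-zeroˡ a

count-sum : ∀ {P : Pred A 0ℓ} (P? : Decidable₁ P) xs → + count P? xs ≡ sumℤ xs (λ a → ⟦ P? a ⟧)
count-sum P? []       = refl
count-sum P? (x ∷ xs) with P? x
... | yes _ = cong sucℤ (count-sum P? xs)
... | no _  = trans (count-sum P? xs) (sym (+-identityˡ _))

∏ : ∀ {t} → (Fin t → ℤ) → ℤ
∏ {zero}  f = 1ℤ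
∏ {suc t} f = f zero * ∏ (f ∘ suc)

∏-⟦⟧ : ∀ {t} {P : Pred (Fin t) 0ℓ} (P? : Decidable₁ P) → ∏ (λ j → ⟦ P? j ⟧) ≡ ⟦ all? P? ⟧
∏-⟦⟧ {zero}  P? = refl
∏-⟦⟧ {suc t} P? = trans (cong (⟦ P? zero ⟧ *_) (∏-⟦⟧ (P? ∘ suc)))
  (trans (sym (⟦⟧-× (P? zero) (all? (P? ∘ suc))))
    (⟦⟧-cong (P? zero ×-dec all? (P? ∘ suc)) (all? P?)
      (λ { (p , ps) zero → p ; (p , ps) (suc j) → ps j }) (λ ps → ps zero , ps ∘ suc)))

-- Polynomial functions, as those annihilated by an iterated difference.
data Poly (f : ℤ → ℤ) : Set where
  null : (∀ k → f k ≡ 0ℤ) → Poly f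
  diff : Poly (λ k → f (sucℤ k) - f k) → Poly f

Poly-cong : ∀ {f g} → f ≗ g → Poly f → Poly g
Poly-cong f≗g (null z) = null λ k → trans (sym (f≗g k)) (z k)
Poly-cong f≗g (diff p) = diff (Poly-cong (λ k → cong₂ _-_ (f≗g (sucℤ k)) (f≗g k)) p)

Poly-const : ∀ a → Poly (λ _ → a)
Poly-const a = diff (null λ _ → i≡j⇒i-j≡0 {a} refl)

Poly-+ : ∀ {f g} → Poly f → Poly g → Poly (λ k → f k + g k)
Poly-+ (null z) q = Poly-cong (λ k → trans (sym (+-identityˡ _)) (cong (_+ _) (sym (z k)))) q
Poly-+ {f} p (null z) = Poly-cong (λ k → trans (sym (+-identityʳ (f k))) (+-congˡ (f k) (sym (z k)))) p
Poly-+ {f} {g} (diff p) (diff q) =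
  diff (Poly-cong (λ k → lemma (f (sucℤ k)) (f k) (g (sucℤ k)) (g k)) (Poly-+ p q))
  where
  lemma : ∀ a b c d → (a - b) + (c - d) ≡ (a + c) - (b + d)
  lemma = solve-∀

Poly-*ˡ : ∀ a {f} → Poly f → Poly (λ k → a * f k)
Poly-*ˡ a (null z) = null λ k → trans (cong (a *_) (z k)) (*-zeroʳ a)
Poly-*ˡ a {f} (diff p) = diff (Poly-cong (λ k → lemma a (f (sucℤ k)) (f k)) (Poly-*ˡ a p))
  where
  lemma : ∀ a b c → a * (b - c) ≡ a * b - a * c
  lemma = solve-∀

-- Horner evaluation multiplies only by a linear factor. By the discrete product rule, the
-- difference of `(k + a) * f k` is `k + a` times the difference of `f`, plus `f (sucℤ k)`, and the
-- latter is the difference of `f` plus `f` itself.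
Poly-shift-* : ∀ a {f} → Poly f → Poly (λ k → (k + a) * f k)
Poly-shift-* a (null z) = null λ k → trans (cong ((k + a) *_) (z k)) (*-zeroʳ (k + a))
Poly-shift-* a {f} (diff p) = diff (Poly-cong (λ k → lemma k a (f (sucℤ k)) (f k))
  (Poly-+ (Poly-shift-* a p) (Poly-+ p (diff p))))
  where
  lemma : ∀ k a b c → (k + a) * (b - c) + ((b - c) + c) ≡ ((1ℤ + k) + a) * b - (k + a) * c
  lemma = solve-∀

Poly-sum : ∀ (xs : List A) {f : A → ℤ → ℤ} → (∀ a → a ∈ˡ xs → Poly (f a)) →
  Poly (λ k → sumℤ xs (λ a → f a k))
Poly-sum []       p = null λ _ → refl
Poly-sum (x ∷ xs) p = Poly-+ (p x (here refl)) (Poly-sum xs λ a a∈ → p a (there a∈))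

suc-invariant⇒constant : ∀ {f : ℤ → ℤ} → (∀ k → f (sucℤ k) ≡ f k) → ∀ k → f k ≡ f 1ℤ
suc-invariant⇒constant inv (+ zero)        = sym (inv (+ 0))
suc-invariant⇒constant inv (+ suc zero)    = refl
suc-invariant⇒constant inv (+ suc (suc n)) = trans (inv (+ suc n)) (suc-invariant⇒constant inv (+ suc n))
suc-invariant⇒constant inv -[1+ zero ]     = trans (sym (inv -[1+ zero ])) (sym (inv (+ 0)))
suc-invariant⇒constant inv -[1+ suc n ]    = trans (sym (inv -[1+ suc n ])) (suc-invariant⇒constant inv -[1+ n ])

-- The difference of `f` vanishes at the positive integers too, hence everywhere by induction. So
-- `f` is constant on all of ℤ, and its value at 1 is zero.
Poly-zero : ∀ {f} → Poly f → (∀ n → f (+ suc n) ≡ 0ℤ) → ∀ k → f k ≡ 0ℤ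
Poly-zero (null z) zeros = z
Poly-zero {f} (diff p) zeros k = trans (suc-invariant⇒constant inv k) (zeros 0)
  where
  inv : ∀ k → f (sucℤ k) ≡ f k
  inv k = i-j≡0⇒i≡j (f (sucℤ k)) (f k)
    (Poly-zero p (λ n → cong₂ _-_ (zeros (suc n)) (zeros n)) k)

Poly-unique : ∀ {f g} → Poly f → Poly g → (∀ n → f (+ suc n) ≡ g (+ suc n)) → ∀ k → f k ≡ g k
Poly-unique {f} {g} p q agree k = i-j≡0⇒i≡j (f k) (g k) (Poly-zero difference
  (λ n → i≡j⇒i-j≡0 (agree n)) k)
  where
  -1* : ∀ a b → a + -1ℤ * b ≡ a - b
  -1* = solve-∀
  difference : Poly (λ k → f k - g k)
  difference = Poly-cong (λ k → -1* (f k) (g k)) (Poly-+ p (Poly-*ˡ -1ℤ q))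

eval₁-Poly : ∀ q → Poly (eval₁ q)
eval₁-Poly []      = null λ _ → refl
eval₁-Poly (a ∷ q) = Poly-+ (Poly-const a)
  (Poly-cong (λ y → cong (_* eval₁ q y) (+-identityʳ y)) (Poly-shift-* 0ℤ (eval₁-Poly q)))

-- After the substitution `x = y + z` the outer Horner factor is `y + z`, which is linear in `y` for
-- fixed `z` and in `z` for fixed `y`.
eval₂-Polyˡ : ∀ p z → Poly (λ y → eval₂ p (y + z) y)
eval₂-Polyˡ []      z = null λ _ → refl
eval₂-Polyˡ (q ∷ p) z = Poly-+ (eval₁-Poly q) (Poly-shift-* z (eval₂-Polyˡ p z))

eval₂-Polyʳ : ∀ p y → Poly (λ z → eval₂ p (y + z) y)
eval₂-Polyʳ []      y = null λ _ → refl
eval₂-Polyʳ (q ∷ p) y = Poly-+ (Poly-const (eval₁ q y))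
  (Poly-cong (λ z → cong (_* eval₂ p (y + z) y) (+-comm z y)) (Poly-shift-* y (eval₂-Polyʳ p y)))

-- The incidence algebra of the Boolean lattice

data Phase : Set where
  past now future : Phase


-- A phase vector is an interval of the Boolean lattice: from the past vertices
-- to those that are past or now. Kernels form its incidence algebra.
Kernel : ℕ → Set
Kernel k = Vec Phase k → ℤ

at : Kernel (suc k) → Phase → Kernel k
at K p s = K (p ∷ s)

infixl 7 _∙_

-- Convolution over the sets that cut the interval in two. A `now` vertex falls either into the
-- first part, and the second factor sees it as `past`, or into the second part, and the first
-- factor sees it as `future`.
_∙_ : Kernel k → Kernel k → Kernel k
(K ∙ L) []           = K [] * L []
(K ∙ L) (past ∷ s)   = (at K past ∙ at L past) s
(K ∙ L) (future ∷ s) = (at K future ∙ at L future) s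
(K ∙ L) (now ∷ s)    = (at K now ∙ at L past) s + (at K future ∙ at L now) s

δ : Kernel k
δ []           = 1ℤ
δ (past ∷ s)   = δ s
δ (now ∷ s)    = 0ℤ
δ (future ∷ s) = δ s

data Cut₁ : Phase → Phase → Phase → Set where
  past   : Cut₁ past past past
  future : Cut₁ future future future
  first  : Cut₁ now now past
  second : Cut₁ now future now

data Cut : Vec Phase k → Vec Phase k → Vec Phase k → Set where
  []  : Cut [] [] []
  _∷_ : ∀ {p q r} {s u u′ : Vec Phase k} → Cut₁ p q r → Cut s u u′ → Cut (p ∷ s) (q ∷ u) (r ∷ u′)

Cut-lookup : ∀ {s u u′ : Vec Phase k} → Cut s u u′ →
  ∀ v → Cut₁ (lookupᵛ s v) (lookupᵛ u v) (lookupᵛ u′ v)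
Cut-lookup (c ∷ cs) zero    = c
Cut-lookup (c ∷ cs) (suc v) = Cut-lookup cs v

prepend : Phase → Phase → Vec Phase k × Vec Phase k → Vec Phase (suc k) × Vec Phase (suc k)
prepend p p′ (u , u′) = p ∷ u , p′ ∷ u′

cuts : Vec Phase k → List (Vec Phase k × Vec Phase k)
cuts []           = ([] , []) ∷ []
cuts (past ∷ s)   = map (prepend past past) (cuts s)
cuts (future ∷ s) = map (prepend future future) (cuts s)
cuts (now ∷ s)    = map (prepend now past) (cuts s) ++ map (prepend future now) (cuts s)

∈-cuts : ∀ (s : Vec Phase k) {u u′} → (u , u′) ∈ˡ cuts s → Cut s u u′
∈-cuts []           (here refl) = []
∈-cuts (past ∷ s)   i with ∈-map⁻ (prepend past past) i
... | _ , j , refl = past ∷ ∈-cuts s j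
∈-cuts (future ∷ s) i with ∈-map⁻ (prepend future future) i
... | _ , j , refl = future ∷ ∈-cuts s j
∈-cuts (now ∷ s)    i with ∈-++⁻ (map (prepend now past) (cuts s)) i
... | inj₁ j with ∈-map⁻ (prepend now past) j
...   | _ , l , refl = first ∷ ∈-cuts s l
∈-cuts (now ∷ s)    i | inj₂ j with ∈-map⁻ (prepend future now) j
...   | _ , l , refl = second ∷ ∈-cuts s l

∙-sum : ∀ (K L : Kernel k) s → (K ∙ L) s ≡ sumℤ (cuts s) (λ (u , u′) → K u * L u′)
∙-sum K L []           = sym (+-identityʳ _)
∙-sum K L (past ∷ s)   = trans (∙-sum (at K past) (at L past) s) (sym (sum-map (cuts s) _ _))
∙-sum K L (future ∷ s) = trans (∙-sum (at K future) (at L future) s) (sym (sum-map (cuts s) _ _))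
∙-sum K L (now ∷ s)    = trans
  (cong₂ _+_
    (trans (∙-sum (at K now) (at L past) s) (sym (sum-map (cuts s) (prepend now past) _)))
    (trans (∙-sum (at K future) (at L now) s) (sym (sum-map (cuts s) (prepend future now) _))))
  (sym (sum-++ (map (prepend now past) (cuts s)) _ _))

∙-cong : ∀ {K K′ L L′ : Kernel k} → K ≗ K′ → L ≗ L′ → K ∙ L ≗ K′ ∙ L′
∙-cong {K = K} {K′} {L} {L′} K≗ L≗ s = trans (∙-sum K L s)
  (trans (sum-cong (cuts s) λ (u , u′) _ → cong₂ _*_ (K≗ u) (L≗ u′)) (sym (∙-sum K′ L′ s)))

∙-zeroˡ : ∀ {K L : Kernel k} → (∀ s → K s ≡ 0ℤ) → ∀ s → (K ∙ L) s ≡ 0ℤ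
∙-zeroˡ {K = K} {L} K≗0 s = trans (∙-sum K L s)
  (sum-zero (cuts s) λ (u , u′) _ → trans (cong (_* L u′) (K≗0 u)) (*-zeroˡ (L u′)))

∙-distribʳ : ∀ (K K′ L : Kernel k) s → ((λ u → K u + K′ u) ∙ L) s ≡ (K ∙ L) s + (K′ ∙ L) s
∙-distribʳ K K′ L s = trans (∙-sum _ L s)
  (trans (sum-cong (cuts s) λ (u , u′) _ → *-distribʳ-+ (L u′) (K u) (K′ u))
    (trans (sum-+ (cuts s) _ _) (sym (cong₂ _+_ (∙-sum K L s) (∙-sum K′ L s)))))

∙-distribˡ : ∀ (K L L′ : Kernel k) s → (K ∙ (λ u → L u + L′ u)) s ≡ (K ∙ L) s + (K ∙ L′) s
∙-distribˡ K L L′ s = trans (∙-sum K _ s)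
  (trans (sum-cong (cuts s) λ (u , u′) _ → *-distribˡ-+ (K u) (L u′) (L′ u′))
    (trans (sum-+ (cuts s) _ _) (sym (cong₂ _+_ (∙-sum K L s) (∙-sum K L′ s)))))

∙-sumʳ : ∀ {A : Set} (xs : List A) (K : Kernel k) (L : A → Kernel k) s →
  (K ∙ (λ u → sumℤ xs (λ a → L a u))) s ≡ sumℤ xs (λ a → (K ∙ L a) s)
∙-sumʳ xs K L s = trans (∙-sum K _ s)
  (trans (sum-cong (cuts s) λ (u , u′) _ → sym (sum-*ˡ xs (K u) (λ a → L a u′)))
    (trans (sum-swap (cuts s) xs _) (sum-cong xs λ a _ → sym (∙-sum K (L a) s))))

-- A `now` vertex is taken up by exactly one of the three factors; these are the three terms on
-- either side.
∙-assoc : ∀ (K L M : Kernel k) → (K ∙ L) ∙ M ≗ K ∙ (L ∙ M)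
∙-assoc K L M []           = *-assoc (K []) (L []) (M [])
∙-assoc K L M (past ∷ s)   = ∙-assoc (at K past) (at L past) (at M past) s
∙-assoc K L M (future ∷ s) = ∙-assoc (at K future) (at L future) (at M future) s
∙-assoc K L M (now ∷ s)    = begin
  ((λ u → (Kₙ ∙ Lₚ) u + (K∞ ∙ Lₙ) u) ∙ Mₚ) s + ((K∞ ∙ L∞) ∙ Mₙ) s
    ≡⟨ cong (_+ ((K∞ ∙ L∞) ∙ Mₙ) s) (∙-distribʳ (Kₙ ∙ Lₚ) (K∞ ∙ Lₙ) Mₚ s) ⟩
  ((Kₙ ∙ Lₚ) ∙ Mₚ) s + ((K∞ ∙ Lₙ) ∙ Mₚ) s + ((K∞ ∙ L∞) ∙ Mₙ) s
    ≡⟨ cong₂ _+_ (cong₂ _+_ (∙-assoc Kₙ Lₚ Mₚ s) (∙-assoc K∞ Lₙ Mₚ s)) (∙-assoc K∞ L∞ Mₙ s) ⟩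
  (Kₙ ∙ (Lₚ ∙ Mₚ)) s + (K∞ ∙ (Lₙ ∙ Mₚ)) s + (K∞ ∙ (L∞ ∙ Mₙ)) s
    ≡⟨ +-assoc ((Kₙ ∙ (Lₚ ∙ Mₚ)) s) _ _ ⟩
  (Kₙ ∙ (Lₚ ∙ Mₚ)) s + ((K∞ ∙ (Lₙ ∙ Mₚ)) s + (K∞ ∙ (L∞ ∙ Mₙ)) s)
    ≡⟨ +-congˡ ((Kₙ ∙ (Lₚ ∙ Mₚ)) s) (sym (∙-distribˡ K∞ (Lₙ ∙ Mₚ) (L∞ ∙ Mₙ) s)) ⟩
  (Kₙ ∙ (Lₚ ∙ Mₚ)) s + (K∞ ∙ (λ u → (Lₙ ∙ Mₚ) u + (L∞ ∙ Mₙ) u)) s ∎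
  where
  open ≡-Reasoning
  Kₙ = at K now
  K∞ = at K future
  Lₚ = at L past
  Lₙ = at L now
  L∞ = at L future
  Mₚ = at M past
  Mₙ = at M now

∙-identityˡ : ∀ (K : Kernel k) → δ ∙ K ≗ K
∙-identityˡ K []           = *-identityˡ (K [])
∙-identityˡ K (past ∷ s)   = ∙-identityˡ (at K past) s
∙-identityˡ K (future ∷ s) = ∙-identityˡ (at K future) s
∙-identityˡ K (now ∷ s)    = trans
  (cong₂ _+_ (∙-zeroˡ {L = at K past} (λ _ → refl) s) (∙-identityˡ (at K now) s)) (+-identityˡ _)

-- The frame of a sign-reversing involution. Moving `x` from the first part to the second matches
-- the cuts with `x` in the first part to the remaining ones, so cancellation within each pair kills
-- the whole sum.
toggle : ∀ {K L : Kernel k} {s} x → lookupᵛ s x ≡ now →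
  (∀ {u u′} → Cut s u u′ → lookupᵛ u x ≡ now →
    K u * L u′ + K (u [ x ]≔ future) * L (u′ [ x ]≔ now) ≡ 0ℤ) →
  (K ∙ L) s ≡ 0ℤ
toggle {K = K} {L} {now ∷ s} zero refl cancel = trans
  (cong₂ _+_ (∙-sum (at K now) (at L past) s) (∙-sum (at K future) (at L now) s))
  (trans (sym (sum-+ (cuts s) _ _)) (sum-zero (cuts s) λ _ i → cancel (first ∷ ∈-cuts s i) refl))
toggle {K = K} {L} {past ∷ s}   (suc x) eq cancel =
  toggle {K = at K past} {at L past} x eq (cancel ∘ (past ∷_))
toggle {K = K} {L} {future ∷ s} (suc x) eq cancel =
  toggle {K = at K future} {at L future} x eq (cancel ∘ (future ∷_))
toggle {K = K} {L} {now ∷ s}    (suc x) eq cancel = cong₂ _+_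
  (toggle {K = at K now} {at L past} x eq (cancel ∘ (first ∷_)))
  (toggle {K = at K future} {at L now} x eq (cancel ∘ (second ∷_)))

nows : Vec Phase k → ℕ
nows []           = 0
nows (past ∷ s)   = nows s
nows (now ∷ s)    = suc (nows s)
nows (future ∷ s) = nows s

nows-Cut : ∀ {s u u′ : Vec Phase k} → Cut s u u′ → nows s ≡ nows u +ℕ nows u′
nows-Cut []         = refl
nows-Cut (past ∷ c)   = nows-Cut c
nows-Cut (future ∷ c) = nows-Cut c
nows-Cut (first ∷ c)  = cong suc (nows-Cut c)
nows-Cut (_∷_ {u = u} second c) = trans (cong suc (nows-Cut c)) (sym (ℕₚ.+-suc (nows u) _))

nows-replicate : ∀ k → nows (replicate k now) ≡ k
nows-replicate zero    = refl
nows-replicate (suc k) = cong suc (nows-replicate k)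

δ-nows≡0 : ∀ (s : Vec Phase k) → nows s ≡ 0 → δ s ≡ 1ℤ
δ-nows≡0 []           _  = refl
δ-nows≡0 (past ∷ s)   eq = δ-nows≡0 s eq
δ-nows≡0 (future ∷ s) eq = δ-nows≡0 s eq

δ-nows≢0 : ∀ (s : Vec Phase k) → nows s ≢ 0 → δ s ≡ 0ℤ
δ-nows≢0 []           ne = contradiction refl ne
δ-nows≢0 (past ∷ s)   ne = δ-nows≢0 s ne
δ-nows≢0 (now ∷ s)    ne = refl
δ-nows≢0 (future ∷ s) ne = δ-nows≢0 s ne

-- Multiplication by the sign is an automorphism: every vertex is now in
-- exactly one of the two factors.
bar : Kernel k → Kernel k
bar K s = -1ℤ ^ nows s * K s

bar-δ : bar {k} δ ≗ δ
bar-δ []           = refl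
bar-δ (past ∷ s)   = bar-δ s
bar-δ (now ∷ s)    = *-zeroʳ (-1ℤ ^ suc (nows s))
bar-δ (future ∷ s) = bar-δ s

bar-∙ : ∀ (K L : Kernel k) → bar K ∙ bar L ≗ bar (K ∙ L)
bar-∙ K L s = trans (∙-sum (bar K) (bar L) s)
  (trans (sum-cong (cuts s) λ (u , u′) i → split u u′ (nows-Cut (∈-cuts s i)))
    (trans (sum-*ˡ (cuts s) (-1ℤ ^ nows s) _) (cong (-1ℤ ^ nows s *_) (sym (∙-sum K L s)))))
  where
  shuffle : ∀ a b c d → (a * b) * (c * d) ≡ (a * c) * (b * d)
  shuffle = solve-∀
  split : ∀ u u′ → nows s ≡ nows u +ℕ nows u′ →
    bar K u * bar L u′ ≡ -1ℤ ^ nows s * (K u * L u′)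
  split u u′ eq rewrite eq = trans (shuffle (-1ℤ ^ nows u) (K u) (-1ℤ ^ nows u′) (L u′))
    (cong (_* (K u * L u′)) (sym (^-distribˡ-+-* -1ℤ (nows u) (nows u′))))

-- Powers of a kernel as polynomial functions of the exponent

iterate : Kernel k → ℕ → Kernel k
iterate K zero    = δ
iterate K (suc n) = K ∙ iterate K n

iterate-bar : ∀ (K : Kernel k) n → iterate (bar K) n ≗ bar (iterate K n)
iterate-bar K zero    s = sym (bar-δ s)
iterate-bar K (suc n) s = trans
  (∙-cong {K = bar K} (λ _ → refl) (iterate-bar K n) s) (bar-∙ K (iterate K n) s)

-- Integer powers, for an inverse K⁻¹ of K.
power : Kernel k → Kernel k → ℤ → Kernel k
power K K⁻¹ (+ n)    = iterate K n
power K K⁻¹ -[1+ n ] = iterate K⁻¹ (suc n)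

power-neg : ∀ (K K⁻¹ : Kernel k) n → power K K⁻¹ (- (+ n)) ≗ iterate K⁻¹ n
power-neg K K⁻¹ zero    s = refl
power-neg K K⁻¹ (suc n) s = refl

cancel-inverse : ∀ {K K⁻¹ : Kernel k} → K ∙ K⁻¹ ≗ δ → ∀ L → L ≗ K ∙ (K⁻¹ ∙ L)
cancel-inverse {K = K} {K⁻¹} inv L s = trans (sym (∙-identityˡ L s))
  (trans (∙-cong {L = L} (λ u → sym (inv u)) (λ _ → refl) s) (∙-assoc K K⁻¹ L s))

-- At a negative exponent the power begins with a factor `K⁻¹`, which multiplication by `K` from the
-- left cancels.
power-suc : ∀ {K K⁻¹ : Kernel k} → K ∙ K⁻¹ ≗ δ →
  ∀ j → power K K⁻¹ (sucℤ j) ≗ K ∙ power K K⁻¹ j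
power-suc inv (+ n)              = λ _ → refl
power-suc inv -[1+ zero ]        = cancel-inverse inv δ
power-suc {K⁻¹ = K⁻¹} inv -[1+ suc n ] = cancel-inverse inv (iterate K⁻¹ (suc n))

-- K − δ vanishes where nothing is now, so that each difference moves to an
-- interval with fewer now vertices.
recurrent⇒Poly : ∀ {K : Kernel k} (F : ℤ → Kernel k) → (∀ s → nows s ≡ 0 → K s ≡ 1ℤ) →
  (∀ j → F (sucℤ j) ≗ K ∙ F j) → ∀ s → Poly (λ j → F j s)
recurrent⇒Poly {k} {K} F unit step s = go (suc (nows s)) s ℕₚ.≤-refl
  where
  difference : ∀ j s → sumℤ (cuts s) (λ (u , u′) → (K u - δ u) * F j u′) ≡ F (sucℤ j) s - F j s
  difference j s = begin
    sumℤ (cuts s) (λ (u , u′) → (K u - δ u) * F j u′)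
      ≡⟨ sum-cong (cuts s) (λ (u , u′) _ → expand (K u) (δ u) (F j u′)) ⟩
    sumℤ (cuts s) (λ (u , u′) → K u * F j u′ + -1ℤ * (δ u * F j u′))
      ≡⟨ sum-+ (cuts s) _ _ ⟩
    sumℤ (cuts s) (λ (u , u′) → K u * F j u′) + sumℤ (cuts s) (λ (u , u′) → -1ℤ * (δ u * F j u′))
      ≡⟨ +-congˡ (sumℤ (cuts s) (λ (u , u′) → K u * F j u′)) (sum-*ˡ (cuts s) -1ℤ _) ⟩
    sumℤ (cuts s) (λ (u , u′) → K u * F j u′) + -1ℤ * sumℤ (cuts s) (λ (u , u′) → δ u * F j u′)
      ≡⟨ cong₂ (λ a b → a + -1ℤ * b)
           (trans (sym (∙-sum K (F j) s)) (sym (step j s)))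
           (trans (sym (∙-sum δ (F j) s)) (∙-identityˡ (F j) s)) ⟩
    F (sucℤ j) s + -1ℤ * F j s
      ≡⟨ +-congˡ (F (sucℤ j) s) (-1*i≡-i (F j s)) ⟩
    F (sucℤ j) s - F j s ∎
    where
    open ≡-Reasoning
    expand : ∀ a b c → (a - b) * c ≡ a * c + -1ℤ * (b * c)
    expand = solve-∀
  go : ∀ m s → nows s < m → Poly (λ j → F j s)
  term : ∀ m s → nows s < suc m → ∀ u u′ → Cut s u u′ → Poly (λ j → (K u - δ u) * F j u′)
  go (suc m) s lt = diff (Poly-cong (λ j → difference j s)
    (Poly-sum (cuts s) λ (u , u′) i → term m s lt u u′ (∈-cuts s i)))
  term m s lt u u′ c with nows u in eq
  ... | zero  = null λ j →
    cong (_* F j u′) (cong₂ _-_ (unit u eq) (δ-nows≡0 u eq))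
  ... | suc n = Poly-*ˡ (K u - δ u) (go m u′ (ℕₚ.≤-trans (s≤s (ℕₚ.m≤n+m (nows u′) n))
    (ℕₚ.≤-trans (ℕₚ.≤-reflexive (trans (cong (_+ℕ nows u′) (sym eq)) (sym (nows-Cut c)))) (ℕₚ.≤-pred lt))))

∙-Polyʳ : ∀ (K : Kernel k) {F : ℤ → Kernel k} → (∀ s → Poly (λ j → F j s)) →
  ∀ s → Poly (λ j → (K ∙ F j) s)
∙-Polyʳ K {F} p s = Poly-cong (λ j → sym (∙-sum K (F j) s))
  (Poly-sum (cuts s) λ (u , u′) _ → Poly-*ˡ (K u) (p u′))

-- Products of kernels as sums over colorings

chain : ∀ {t} → (Fin t → Kernel k) → Kernel k
chain {t = zero}  Φ = δ
chain {t = suc t} Φ = Φ zero ∙ chain (Φ ∘ suc)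

chain-const : ∀ (K : Kernel k) t → chain {t = t} (λ _ → K) ≗ iterate K t
chain-const K zero    s = refl
chain-const K (suc t) s = ∙-cong {K = K} (λ _ → refl) (chain-const K t) s

-- The test computes along the induction on `y ≤ x`: it is `false` throughout for bound zero, and
-- `toℕ (suc j) <ᵇ suc y` reduces to `toℕ j <ᵇ y`, so dropping the first factor leaves the same
-- statement for smaller bounds.
chain-threshold : ∀ (K : Bool → Kernel k) {x y} → y ≤ x →
  chain {t = x} (λ j → K (toℕ j <ᵇ y)) ≗ iterate (K true) y ∙ iterate (K false) (x ∸ y)
chain-threshold K {x} z≤n s = trans (chain-const (K false) x s) (sym (∙-identityˡ _ s))
chain-threshold K (s≤s y≤x) s = trans
  (∙-cong {K = K true} (λ _ → refl) (chain-threshold K y≤x) s)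
  (sym (∙-assoc (K true) _ _ s))

-- The phase at time j of a vertex of color i.
phase : ∀ {t} → Fin t → Fin t → Phase
phase zero    zero    = now
phase zero    (suc i) = future
phase (suc j) zero    = past
phase (suc j) (suc i) = phase j i

chain-past : ∀ {t} (Φ : Fin t → Kernel (suc k)) →
  at (chain Φ) past ≗ chain (λ j → at (Φ j) past)
chain-past {t = zero}  Φ s = refl
chain-past {t = suc t} Φ s = ∙-cong {K = at (Φ zero) past} (λ _ → refl) (chain-past (Φ ∘ suc)) s

sum-allFin-suc : ∀ {t} (f : Fin (suc t) → ℤ) →
  sumℤ (allFin (suc t)) f ≡ f zero + sumℤ (allFin t) (f ∘ suc)
sum-allFin-suc {t} f = +-congˡ (f zero)
  (trans (cong (λ xs → sumℤ xs f) (sym (map-tabulate (λ i → i) suc))) (sum-map (allFin t) suc f))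

-- The leading vertex is taken up by exactly one factor. The index `i` of this factor becomes its
-- color, and the earlier factors see it as `future`, the later ones as `past`.
chain-now : ∀ {t} (Φ : Fin t → Kernel (suc k)) s →
  chain Φ (now ∷ s) ≡ sumℤ (allFin t) (λ i → chain (λ j → at (Φ j) (phase j i)) s)
chain-now {t = zero}  Φ s = refl
chain-now {t = suc t} Φ s = trans
  (cong₂ _+_
    (∙-cong {K = at (Φ zero) now} (λ _ → refl) (chain-past (Φ ∘ suc)) s)
    (trans (∙-cong {K = at (Φ zero) future} (λ _ → refl) (chain-now (Φ ∘ suc)) s)
      (∙-sumʳ (allFin t) (at (Φ zero) future)
        (λ i → chain (λ j → at (Φ (suc j)) (phase j i))) s)))
  (sym (sum-allFin-suc (λ i → chain (λ j → at (Φ j) (phase j i)) s)))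

chain-[] : ∀ {t} (Φ : Fin t → Kernel 0) → chain Φ [] ≡ ∏ (λ j → Φ j [])
chain-[] {zero}  Φ = refl
chain-[] {suc t} Φ = cong (Φ zero [] *_) (chain-[] (Φ ∘ suc))

-- Each use of `chain-now` fixes the color of one vertex and leaves a product of kernels on one
-- vertex fewer. When no vertex is left, the kernels are numbers.
chain-colorings : ∀ {t} (Φ : Fin t → Kernel k) →
  chain Φ (replicate k now) ≡ sumℤ (colorings t k) (λ c → ∏ (λ j → Φ j (mapᵛ (phase j) c)))
chain-colorings {k = zero}  Φ = trans (chain-[] Φ) (sym (+-identityʳ _))
chain-colorings {k = suc k} {t} Φ = trans (chain-now Φ (replicate k now))
  (trans (sum-cong (allFin t) λ i _ → chain-colorings (λ j → at (Φ j) (phase j i)))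
    (sym (sum-cartesianProductWith _∷_ (allFin t) (colorings t k) _)))

-- Reciprocity for a fixed acyclic orientation

_≟ᵖ_ : (p q : Phase) → Dec (p ≡ q)
past   ≟ᵖ past   = yes refl
past   ≟ᵖ now    = no λ ()
past   ≟ᵖ future = no λ ()
now    ≟ᵖ past   = no λ ()
now    ≟ᵖ now    = yes refl
now    ≟ᵖ future = no λ ()
future ≟ᵖ past   = no λ ()
future ≟ᵖ now    = no λ ()
future ≟ᵖ future = yes refl

phase-now : ∀ {t} (j : Fin t) → phase j j ≡ now
phase-now zero    = refl
phase-now (suc j) = phase-now j

phase-now⁻ : ∀ {t} (j i : Fin t) → phase j i ≡ now → i ≡ j
phase-now⁻ zero    zero    _  = refl
phase-now⁻ (suc j) (suc i) eq = cong suc (phase-now⁻ j i eq)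

phase-past : ∀ {t} (j i : Fin t) → toℕ i < toℕ j → phase j i ≡ past
phase-past (suc j) zero    _        = refl
phase-past (suc j) (suc i) (s≤s lt) = phase-past j i lt

phase-past⁻ : ∀ {t} (j i : Fin t) → phase j i ≡ past → toℕ i < toℕ j
phase-past⁻ (suc j) zero    _  = s≤s z≤n
phase-past⁻ (suc j) (suc i) eq = s≤s (phase-past⁻ j i eq)

phase-≢future : ∀ {t} (j i : Fin t) → toℕ i ≤ toℕ j → phase j i ≢ future
phase-≢future zero    zero    _        ()
phase-≢future (suc j) zero    _        ()
phase-≢future (suc j) (suc i) (s≤s le) eq = phase-≢future j i le eq

phase-≢future⁻ : ∀ {t} (j i : Fin t) → phase j i ≢ future → toℕ i ≤ toℕ j
phase-≢future⁻ zero    zero    _  = z≤n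
phase-≢future⁻ zero    (suc i) ne = contradiction refl ne
phase-≢future⁻ (suc j) zero    _  = z≤n
phase-≢future⁻ (suc j) (suc i) ne = s≤s (phase-≢future⁻ j i ne)

now-cut : ∀ {p q r} → Cut₁ p q r → p ≡ now → q ≡ now ⊎ r ≡ now
now-cut first  _ = inj₁ refl
now-cut second _ = inj₂ refl

nows-update : ∀ {k} (s : Vec Phase k) x → lookupᵛ s x ≡ past → nows (s [ x ]≔ now) ≡ suc (nows s)
nows-update (past ∷ s)   zero    refl = refl
nows-update (past ∷ s)   (suc x) eq   = nows-update s x eq
nows-update (now ∷ s)    (suc x) eq   = cong suc (nows-update s x eq)
nows-update (future ∷ s) (suc x) eq   = nows-update s x eq

now⇒nows≢0 : ∀ {k} (s : Vec Phase k) v → lookupᵛ s v ≡ now → nows s ≢ 0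
now⇒nows≢0 (now ∷ s)    zero    _  = λ ()
now⇒nows≢0 (past ∷ s)   (suc v) eq = now⇒nows≢0 s v eq
now⇒nows≢0 (now ∷ s)    (suc v) eq = λ ()
now⇒nows≢0 (future ∷ s) (suc v) eq = now⇒nows≢0 s v eq

nows≢0⇒now : ∀ {k} (s : Vec Phase k) → nows s ≢ 0 → ∃ λ v → lookupᵛ s v ≡ now
nows≢0⇒now []           ne = contradiction refl ne
nows≢0⇒now (now ∷ s)    ne = zero , refl
nows≢0⇒now (past ∷ s)   ne = let v , eq = nows≢0⇒now s ne in suc v , eq
nows≢0⇒now (future ∷ s) ne = let v , eq = nows≢0⇒now s ne in suc v , eq

∙-nows≡0 : ∀ {k} (K L : Kernel k) s → nows s ≡ 0 → (K ∙ L) s ≡ K s * L s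
∙-nows≡0 K L []           eq = refl
∙-nows≡0 K L (past ∷ s)   eq = ∙-nows≡0 (at K past) (at L past) s eq
∙-nows≡0 K L (future ∷ s) eq = ∙-nows≡0 (at K future) (at L future) s eq

-- Colorings increasing along the arcs of R, with colors above y on C: color
-- classes are added one at a time, and those with low = true must avoid C.
module Steps {k : ℕ} {R : Rel (Fin k) 0ℓ} (R? : Decidable R)
             {C : Pred (Fin k) 0ℓ} (C? : Decidable₁ C) where

  -- `Before` lists the phases allowed to an in-neighbor of a vertex that is receiving its color:
  -- only `past` for strictly increasing colorings, `past` or `now` for weakly increasing ones. Both
  -- cases share the translation between kernels and colorings.
  module Step {Before : Pred Phase 0ℓ} (before? : Decidable₁ Before) where

    Step : Bool → Vec Phase k → Set
    Step low s = ∀ w → lookupᵛ s w ≡ now →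
      (T low → ¬ C w) × (∀ v → R v w → Before (lookupᵛ s v))

    step? : ∀ low → Decidable₁ (Step low)
    step? low s = all? λ w → (lookupᵛ s w ≟ᵖ now) →-dec
      ((T? low →-dec ¬? (C? w)) ×-dec (all? λ v → R? v w →-dec before? (lookupᵛ s v)))

    kernel : Bool → Kernel k
    kernel low s = ⟦ step? low s ⟧

    kernel-unit : ∀ low s → nows s ≡ 0 → kernel low s ≡ 1ℤ
    kernel-unit low s eq = ⟦⟧-true (step? low s) λ w w-now → contradiction eq (now⇒nows≢0 s w w-now)

    module _ {_⊴_ : Rel ℕ 0ℓ} (_⊴?_ : Decidable _⊴_)
             (from : ∀ {t} (j i : Fin t) → toℕ i ⊴ toℕ j → Before (phase j i))
             (to   : ∀ {t} (j i : Fin t) → Before (phase j i) → toℕ i ⊴ toℕ j)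
             {x : ℕ} (y : ℕ) where

      Respects : Coloring x k → Set
      Respects c = (∀ v w → R v w → toℕ (lookupᵛ c v) ⊴ toℕ (lookupᵛ c w)) ×
                   (∀ v → C v → y < color c v)

      respects? : Decidable₁ Respects
      respects? c =
        (all? λ v → all? λ w → R? v w →-dec (toℕ (lookupᵛ c v) ⊴? toℕ (lookupᵛ c w)))
        ×-dec all? λ v → C? v →-dec (y <? color c v)

      Respects⇒Step : ∀ c → Respects c → ∀ j → Step (toℕ j <ᵇ y) (mapᵛ (phase j) c)
      Respects⇒Step c (arcs , high) j w w-now
        with refl ← phase-now⁻ j (lookupᵛ c w) (trans (sym (lookup-map w (phase j) c)) w-now) =
        -- `color` is one more than the index, so an index below `y` is a color that is at most `y`.
        (λ j<y Cw → contradiction (high w Cw) (ℕₚ.≤⇒≯ (ℕₚ.<ᵇ⇒< _ y j<y))) ,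
        λ v vw → subst Before (sym (lookup-map v (phase j) c)) (from j (lookupᵛ c v) (arcs v w vw))

      Step⇒Respects : ∀ c → (∀ j → Step (toℕ j <ᵇ y) (mapᵛ (phase j) c)) → Respects c
      Step⇒Respects c steps =
        (λ v w vw → to _ _ (subst Before (lookup-map v _ c) (proj₂ (at-own-time w) v vw))) ,
        (λ w Cw → s≤s (ℕₚ.≮⇒≥ λ lt → proj₁ (at-own-time w) (ℕₚ.<⇒<ᵇ lt) Cw))
        where
        -- Among all the steps, the one whose index is the color of `w` is the one with `w` now, so
        -- it carries the conditions on `w`.
        at-own-time : ∀ w → (T (toℕ (lookupᵛ c w) <ᵇ y) → ¬ C w) ×
          (∀ v → R v w → Before (lookupᵛ (mapᵛ (phase (lookupᵛ c w)) c) v))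
        at-own-time w = steps (lookupᵛ c w) w
          (trans (lookup-map w (phase (lookupᵛ c w)) c) (phase-now (lookupᵛ c w)))

      kernel-count : y ≤ x →
        (iterate (kernel true) y ∙ iterate (kernel false) (x ∸ y)) (replicate k now) ≡
        sumℤ (colorings x k) (λ c → ⟦ respects? c ⟧)
      kernel-count y≤x = begin
        (iterate (kernel true) y ∙ iterate (kernel false) (x ∸ y)) (replicate k now)
          ≡⟨ sym (chain-threshold kernel y≤x (replicate k now)) ⟩
        chain (λ (j : Fin x) → kernel (toℕ j <ᵇ y)) (replicate k now)
          ≡⟨ chain-colorings (λ (j : Fin x) → kernel (toℕ j <ᵇ y)) ⟩
        sumℤ (colorings x k) (λ c → ∏ λ j → ⟦ step? (toℕ j <ᵇ y) (mapᵛ (phase j) c) ⟧)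
          ≡⟨ sum-cong (colorings x k) (λ c _ → trans
               (∏-⟦⟧ (λ j → step? (toℕ j <ᵇ y) (mapᵛ (phase j) c)))
               (⟦⟧-cong (all? λ j → step? (toℕ j <ᵇ y) (mapᵛ (phase j) c)) (respects? c)
                 (Step⇒Respects c) (Respects⇒Step c))) ⟩
        sumℤ (colorings x k) (λ c → ⟦ respects? c ⟧) ∎
        where open ≡-Reasoning

  open Step (_≟ᵖ past) public using () renaming
    (Step to StrictStep; step? to strictStep?; kernel to strict; kernel-unit to strict-unit)
  open Step (λ p → ¬? (p ≟ᵖ future)) public using () renaming
    (Step to WeakStep; step? to weakStep?; kernel to weak; kernel-unit to weak-unit)

  strict? : ∀ {x} (y : ℕ) → Decidable₁ _
  strict? {x} = Step.respects? (_≟ᵖ past) _<?_ phase-past phase-past⁻ {x}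

  weak? : ∀ {x} (y : ℕ) → Decidable₁ _
  weak? {x} = Step.respects? (λ p → ¬? (p ≟ᵖ future)) _≤?_ phase-≢future phase-≢future⁻ {x}

  -- The argument `replicate k now` is the interval from the empty set to the whole vertex set. The
  -- kernels `bar (weak _)` are written in as inverses here; `strict-inverse` justifies this for
  -- acyclic `R`.
  orderPolynomial : ℤ → ℤ → ℤ
  orderPolynomial y z =
    (power (strict true) (bar (weak true)) y ∙ power (strict false) (bar (weak false)) z)
    (replicate k now)

  module _ (acyclic : ∀ v → ¬ TransClosure R v v) where

    wellFounded : WellFounded (TransClosure R)
    wellFounded = spo-wellFounded {_≈_ = _≡_} record
      { isEquivalence = isEquivalence
      ; irrefl        = λ { refl → acyclic _ }
      ; trans         = _++⁺_
      ; <-resp-≈      = resp₂ _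
      }

    -- Descent along `R` through `now` vertices ends by well-foundedness. The in-neighbors of the
    -- last vertex are not `now`, as the descent has ended, and not `future`, as `s` is a weak step.
    -- Such a vertex can be moved freely between the two parts of a cut.
    minimal-now : ∀ s {low} → WeakStep low s → ∀ v → lookupᵛ s v ≡ now →
      ∃ λ x → lookupᵛ s x ≡ now × (∀ v → R v x → lookupᵛ s v ≡ past)
    minimal-now s weak-s v v-now = go v v-now (wellFounded v)
      where
      go : ∀ x → lookupᵛ s x ≡ now → Acc (TransClosure R) x →
        ∃ λ x → lookupᵛ s x ≡ now × (∀ v → R v x → lookupᵛ s v ≡ past)
      go x x-now (acc rec) with any? (λ v → R? v x ×-dec (lookupᵛ s v ≟ᵖ now))
      ... | yes (v , vx , v-now) = go v v-now (rec [ vx ])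
      ... | no none = x , x-now , λ v vx → is-past v vx (proj₂ (weak-s x x-now) v vx)
        where
        is-past : ∀ v → R v x → lookupᵛ s v ≢ future → lookupᵛ s v ≡ past
        is-past v vx ≢future with lookupᵛ s v in eq
        ... | past   = refl
        ... | now    = contradiction (v , vx , eq) none
        ... | future = contradiction refl ≢future

    -- Contraposed, it removes every term of the product at an `s` that is no weak step. An
    -- in-neighbor that is `past` in `u` is `past` in `s`, and one that is not `future` in `u′` is
    -- `past` or `now` in `s`.
    strict-weak-cut : ∀ {low s u u′} → Cut s u u′ → StrictStep low u → WeakStep low u′ → WeakStep low s
    strict-weak-cut {s = s} cut strict-u weak-u′ w w-now with now-cut (Cut-lookup cut w) w-now
    ... | inj₁ u-now  = let allowed , ins = strict-u w u-now in
      allowed , λ v vw → past-in-u (Cut-lookup cut v) (ins v vw)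
      where
      past-in-u : ∀ {p q r} → Cut₁ p q r → q ≡ past → p ≢ future
      past-in-u past _ ()
    ... | inj₂ u′-now = let allowed , ins = weak-u′ w u′-now in
      allowed , λ v vw → not-future-in-u′ (Cut-lookup cut v) (ins v vw)
      where
      not-future-in-u′ : ∀ {p q r} → Cut₁ p q r → r ≢ future → p ≢ future
      not-future-in-u′ future ne refl = ne refl

    module Toggle {low s u u′} (cut : Cut s u u′) (weak-s : WeakStep low s) (x : Fin k)
                  (x-now : lookupᵛ s x ≡ now) (ins : ∀ v → R v x → lookupᵛ s v ≡ past)
                  (u-now : lookupᵛ u x ≡ now) where

      u′-past : lookupᵛ u′ x ≡ past
      u′-past = go (Cut-lookup cut x) u-now
        where
        go : ∀ {p q r} → Cut₁ p q r → q ≡ now → r ≡ past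
        go first _ = refl

      past-in-both : ∀ {p q r} → Cut₁ p q r → p ≡ past → q ≡ past × r ≡ past
      past-in-both past _ = refl , refl

      update-other : ∀ {v} (t : Vec Phase k) p → v ≢ x → lookupᵛ (t [ x ]≔ p) v ≡ lookupᵛ t v
      update-other t p v≢x = lookup∘update′ v≢x t p

      -- For the other vertices it only matters whether `x` is `past`, and neither `now` nor
      -- `future` is. The conditions on `x` itself hold anyway: its in-neighbors are `past` already
      -- in `s`, and `weak-s` keeps it out of `C` when `low` is true.
      strict-toggle : strict low u ≡ strict low (u [ x ]≔ future)
      strict-toggle = ⟦⟧-cong (strictStep? low u) (strictStep? low (u [ x ]≔ future)) forth back
        where
        forth : StrictStep low u → StrictStep low (u [ x ]≔ future)
        forth st w w-now with w ≟ x
        ... | yes refl = contradiction (trans (sym (lookup∘update x u future)) w-now) λ ()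
        ... | no w≢x   = proj₁ step , λ v vw → go v (proj₂ step v vw)
          where
          step = st w (trans (sym (update-other u future w≢x)) w-now)
          go : ∀ v → lookupᵛ u v ≡ past → lookupᵛ (u [ x ]≔ future) v ≡ past
          go v v-past with v ≟ x
          ... | yes refl = contradiction (trans (sym u-now) v-past) λ ()
          ... | no v≢x   = trans (update-other u future v≢x) v-past
        back : StrictStep low (u [ x ]≔ future) → StrictStep low u
        back st w w-now with w ≟ x
        ... | yes refl = proj₁ (weak-s x x-now) ,
          λ v vx → proj₁ (past-in-both (Cut-lookup cut v) (ins v vx))
        ... | no w≢x   = proj₁ step , λ v vw → go v (proj₂ step v vw)
          where
          step = st w (trans (update-other u future w≢x) w-now)
          go : ∀ v → lookupᵛ (u [ x ]≔ future) v ≡ past → lookupᵛ u v ≡ past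
          go v v-past with v ≟ x
          ... | yes refl = contradiction (trans (sym (lookup∘update x u future)) v-past) λ ()
          ... | no v≢x   = trans (sym (update-other u future v≢x)) v-past

      -- Dually, for the other vertices it only matters whether `x` is `future`, and neither `past`
      -- nor `now` is.
      weak-toggle : weak low u′ ≡ weak low (u′ [ x ]≔ now)
      weak-toggle = ⟦⟧-cong (weakStep? low u′) (weakStep? low (u′ [ x ]≔ now)) forth back
        where
        forth : WeakStep low u′ → WeakStep low (u′ [ x ]≔ now)
        forth st w w-now with w ≟ x
        ... | yes refl = proj₁ (weak-s x x-now) , λ v vx → go v (ins v vx)
          where
          go : ∀ v → lookupᵛ s v ≡ past → lookupᵛ (u′ [ x ]≔ now) v ≢ future
          go v v-past v-future with v ≟ x
          ... | yes refl = contradiction (trans (sym x-now) v-past) λ ()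
          ... | no v≢x   = contradiction
            (trans (sym (proj₂ (past-in-both (Cut-lookup cut v) v-past)))
              (trans (sym (update-other u′ now v≢x)) v-future)) λ ()
        ... | no w≢x   = proj₁ step , λ v vw → go v (proj₂ step v vw)
          where
          step = st w (trans (sym (update-other u′ now w≢x)) w-now)
          go : ∀ v → lookupᵛ u′ v ≢ future → lookupᵛ (u′ [ x ]≔ now) v ≢ future
          go v ne v-future with v ≟ x
          ... | yes refl = contradiction (trans (sym (lookup∘update x u′ now)) v-future) λ ()
          ... | no v≢x   = ne (trans (sym (update-other u′ now v≢x)) v-future)
        back : WeakStep low (u′ [ x ]≔ now) → WeakStep low u′
        back st w w-now with w ≟ x
        ... | yes refl = contradiction (trans (sym u′-past) w-now) λ ()
        ... | no w≢x   = proj₁ step , λ v vw → go v (proj₂ step v vw)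
          where
          step = st w (trans (update-other u′ now w≢x) w-now)
          go : ∀ v → lookupᵛ (u′ [ x ]≔ now) v ≢ future → lookupᵛ u′ v ≢ future
          go v ne v-future with v ≟ x
          ... | yes refl = contradiction (trans (sym u′-past) v-future) λ ()
          ... | no v≢x   = ne (trans (update-other u′ now v≢x) v-future)

      terms-cancel : strict low u * bar (weak low) u′ +
        strict low (u [ x ]≔ future) * bar (weak low) (u′ [ x ]≔ now) ≡ 0ℤ
      -- Both products have the same factors up to sign; the partner of `u′` has one more `now`
      -- vertex, which contributes the factor `-1ℤ`.
      terms-cancel rewrite sym strict-toggle | sym weak-toggle | nows-update u′ x u′-past =
        lemma (strict low u) (-1ℤ ^ nows u′) (weak low u′)
        where
        lemma : ∀ a b c → a * (b * c) + a * (-1ℤ * b * c) ≡ 0ℤ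
        lemma = solve-∀

    -- On a nonempty interval the product must vanish. If `s` is no weak step, each term is zero.
    -- Otherwise the cuts cancel in pairs by moving a minimal `now` vertex, which is chosen from `s`
    -- alone, so that both cuts of a pair move the same vertex.
    strict-inverse : ∀ low → strict low ∙ bar (weak low) ≗ δ
    strict-inverse low s with nows s ℕₚ.≟ 0
    ... | yes none = begin
      (strict low ∙ bar (weak low)) s                ≡⟨ ∙-nows≡0 (strict low) (bar (weak low)) s none ⟩
      strict low s * (-1ℤ ^ nows s * weak low s)
        ≡⟨ cong₂ _*_ (strict-unit low s none) (cong₂ _*_ (cong (-1ℤ ^_) none) (weak-unit low s none)) ⟩
      1ℤ                                             ≡⟨ sym (δ-nows≡0 s none) ⟩
      δ s                                            ∎
      where open ≡-Reasoning
    ... | no some with weakStep? low s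
    ...   | yes weak-s =
      let v , v-now       = nows≢0⇒now s some
          x , x-now , ins = minimal-now s weak-s v v-now
      in trans (toggle {K = strict low} {bar (weak low)} {s} x x-now λ cut u-now →
                Toggle.terms-cancel cut weak-s x x-now ins u-now)
               (sym (δ-nows≢0 s some))
    ...   | no ¬weak-s = trans (∙-sum (strict low) (bar (weak low)) s)
      (trans (sum-zero (cuts s) λ (u , u′) i → vanish u u′ (∈-cuts s i)) (sym (δ-nows≢0 s some)))
      where
      vanish : ∀ u u′ → Cut s u u′ → strict low u * bar (weak low) u′ ≡ 0ℤ
      vanish u u′ cut = ⟦⟧-vanish (strictStep? low u) (bar (weak low) u′) λ strict-u →
        trans (cong (-1ℤ ^ nows u′ *_) (⟦⟧-false (weakStep? low u′)
                λ weak-u′ → ¬weak-s (strict-weak-cut cut strict-u weak-u′)))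
              (*-zeroʳ (-1ℤ ^ nows u′))

    orderPolynomial-Polyˡ : ∀ z → Poly (λ y → orderPolynomial y z)
    orderPolynomial-Polyˡ z = recurrent⇒Poly {K = strict true}
      (λ y → power (strict true) (bar (weak true)) y ∙ tail) (strict-unit true)
      (λ j s → trans (∙-cong {L = tail} (power-suc (strict-inverse true) j) (λ _ → refl) s)
        (∙-assoc (strict true) (power (strict true) (bar (weak true)) j) tail s))
      (replicate k now)
      where tail = power (strict false) (bar (weak false)) z

    orderPolynomial-Polyʳ : ∀ y → Poly (λ z → orderPolynomial y z)
    orderPolynomial-Polyʳ y = ∙-Polyʳ (power (strict true) (bar (weak true)) y)
      (recurrent⇒Poly {K = strict false} (power (strict false) (bar (weak false)))
        (strict-unit false) (power-suc (strict-inverse false)))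
      (replicate k now)

    module _ {x y : ℕ} (y≤x : y ≤ x) where

      orderPolynomial-strict : orderPolynomial (+ y) (+ (x ∸ y)) ≡
        sumℤ (colorings x k) (λ c → ⟦ strict? y c ⟧)
      orderPolynomial-strict = Step.kernel-count (_≟ᵖ past) _<?_ phase-past phase-past⁻ y y≤x

      orderPolynomial-weak : orderPolynomial (- (+ y)) (- (+ (x ∸ y))) ≡
        -1ℤ ^ k * sumℤ (colorings x k) (λ c → ⟦ weak? y c ⟧)
      orderPolynomial-weak = begin
        orderPolynomial (- (+ y)) (- (+ (x ∸ y)))
          ≡⟨ ∙-cong (power-neg (strict true) (bar (weak true)) y)
               (power-neg (strict false) (bar (weak false)) (x ∸ y)) (replicate k now) ⟩
        (iterate (bar (weak true)) y ∙ iterate (bar (weak false)) (x ∸ y)) (replicate k now)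
          ≡⟨ ∙-cong (iterate-bar (weak true) y) (iterate-bar (weak false) (x ∸ y)) (replicate k now) ⟩
        (bar (iterate (weak true) y) ∙ bar (iterate (weak false) (x ∸ y))) (replicate k now)
          ≡⟨ bar-∙ (iterate (weak true) y) (iterate (weak false) (x ∸ y)) (replicate k now) ⟩
        -1ℤ ^ nows (replicate k now) *
          (iterate (weak true) y ∙ iterate (weak false) (x ∸ y)) (replicate k now)
          ≡⟨ cong₂ (λ n a → -1ℤ ^ n * a) (nows-replicate k)
               (Step.kernel-count (λ p → ¬? (p ≟ᵖ future)) _≤?_ phase-≢future phase-≢future⁻ y y≤x) ⟩
        -1ℤ ^ k * sumℤ (colorings x k) (λ c → ⟦ weak? y c ⟧) ∎
        where open ≡-Reasoning

-- Proper colorings and acyclic orientations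

vectors-Unique : ∀ {xs : List A} → Unique xs → ∀ n → Unique (vectors xs n)
vectors-Unique uniq zero    = [] ∷ []
vectors-Unique uniq (suc n) = cartesianProductWith⁺ _∷_ ∷-injective uniq (vectors-Unique uniq n)

∈-vectors : ∀ {xs : List A} → (∀ a → a ∈ˡ xs) → (v : Vec A n) → v ∈ˡ vectors xs n
∈-vectors all []      = here refl
∈-vectors all (a ∷ v) = ∈-cartesianProductWith⁺ _∷_ (all a) (∈-vectors all v)

colorings-Unique : ∀ x n → Unique (colorings x n)
colorings-Unique x = vectors-Unique (allFin⁺ x)

∈-colorings : (c : Coloring x n) → c ∈ˡ colorings x n
∈-colorings = ∈-vectors ∈-allFin

subsets-Unique : ∀ n → Unique (subsets n)
subsets-Unique = vectors-Unique (((λ ()) ∷ []) ∷ [] ∷ [])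

∈-subsets : (B : Subset n) → B ∈ˡ subsets n
∈-subsets = ∈-vectors λ { true → here refl ; false → there (here refl) }

lookup-ext : ∀ {u v : Vec A n} → (∀ i → lookupᵛ u i ≡ lookupᵛ v i) → u ≡ v
lookup-ext eq = Pointwise-≡⇒≡ (ext eq)

module _ {P : Pred (Fin n) 0ℓ} (P? : Decidable₁ P) where

  comprehension : Subset n
  comprehension = tabulate (does ∘ P?)

  ∈-comprehension⁺ : ∀ {v} → P v → v ∈ comprehension
  ∈-comprehension⁺ {v} p = lookup⇒[]= v comprehension
    (trans (lookup∘tabulate (does ∘ P?) v) (dec-true (P? v) p))

  ∈-comprehension⁻ : ∀ {v} → v ∈ comprehension → P v
  ∈-comprehension⁻ {v} v∈ with P? v | trans (sym (lookup∘tabulate (does ∘ P?) v)) ([]=⇒lookup v∈)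
  ... | yes p | _ = p
  ... | no _  | ()

module _ (H : Graph k) {C : Pred (Fin k) 0ℓ} (C? : Decidable₁ C) (y : ℕ) where

  ProperAbove : Coloring x k → Set
  ProperAbove c = (∀ v w → Adj H v w → color c v ≢ color c w) × (∀ v → C v → y < color c v)

  properAbove? : Decidable₁ (ProperAbove {x})
  properAbove? c =
    (all? λ v → all? λ w → adj? H v w →-dec ¬? (color c v ≟ℕ color c w))
    ×-dec all? λ v → C? v →-dec (y <? color c v)

module _ (H : Graph k) (c : Coloring x k) where

  Ascent : Rel (Fin k) 0ℓ
  Ascent v w = Adj H v w × toℕ (lookupᵛ c v) < toℕ (lookupᵛ c w)

  ascent? : Decidable Ascent
  ascent? v w = adj? H v w ×-dec (toℕ (lookupᵛ c v) <? toℕ (lookupᵛ c w))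

  ascents : Orientation k
  ascents = tabulate (λ v → comprehension (ascent? v))

  ascents-Arc⁺ : ∀ {v w} → Ascent v w → Arc ascents v w
  ascents-Arc⁺ {v} {w} a = subst (w ∈_) (sym (lookup∘tabulate (λ v → comprehension (ascent? v)) v))
    (∈-comprehension⁺ (ascent? v) a)

  ascents-Arc⁻ : ∀ {v w} → Arc ascents v w → Ascent v w
  ascents-Arc⁻ {v} {w} a = ∈-comprehension⁻ (ascent? v)
    (subst (w ∈_) (lookup∘tabulate (λ v → comprehension (ascent? v)) v) a)

  ascents-increasing : ∀ {v w} → TransClosure (Arc ascents) v w → toℕ (lookupᵛ c v) < toℕ (lookupᵛ c w)
  ascents-increasing [ a ]    = proj₂ (ascents-Arc⁻ a)
  ascents-increasing (a ∷⁺ p) = ℕₚ.<-trans (proj₂ (ascents-Arc⁻ a)) (ascents-increasing p)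

  -- Properness rules out ties, so every edge gets exactly one direction; the colors increase
  -- strictly along directed walks, so no walk closes up.
  ascents∈acyclicOrientations : (∀ v w → Adj H v w → color c v ≢ color c w) →
    ascents ∈ˡ acyclicOrientations H
  ascents∈acyclicOrientations proper = ∈-filter⁺ _ (∈-vectors ∈-subsets ascents)
    (((λ v w → proj₁ ∘ ascents-Arc⁻) , orient) , λ v cycle → ℕₚ.<-irrefl refl (ascents-increasing cycle))
    where
    orient : ∀ v w → Adj H v w → _
    orient v w vw with ℕₚ.<-cmp (toℕ (lookupᵛ c v)) (toℕ (lookupᵛ c w))
    ... | tri< lt _ _ = inj₁ (ascents-Arc⁺ (vw , lt) , λ wv → ℕₚ.<-asym lt (proj₂ (ascents-Arc⁻ wv)))
    ... | tri≈ _ eq _ = contradiction (cong suc eq) (proper v w vw)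
    ... | tri> _ _ gt = inj₂ (ascents-Arc⁺ (symm H vw , gt) , λ vw → ℕₚ.<-asym gt (proj₂ (ascents-Arc⁻ vw)))

  ascents-unique : ∀ {σ} → IsOrientation H σ →
    (∀ v w → Arc σ v w → toℕ (lookupᵛ c v) < toℕ (lookupᵛ c w)) → σ ≡ ascents
  ascents-unique {σ} (sound , total) increasing = lookup-ext λ v → ⊆-antisym
    (λ {w} vw → ascents-Arc⁺ {v} (sound v w vw , increasing v w vw))
    (λ {w} vw → ascent⇒arc (ascents-Arc⁻ {v} {w} vw))
    where
    ascent⇒arc : ∀ {v w} → Ascent v w → Arc σ v w
    ascent⇒arc {v} {w} (vw , lt) with total v w vw
    ... | inj₁ (arc , _) = arc
    ... | inj₂ (arc , _) = contradiction (increasing w v arc) (ℕₚ.<-asym lt)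

acyclicOrientations-Unique : (H : Graph k) → Unique (acyclicOrientations H)
acyclicOrientations-Unique {k} H = filter⁺ _ (vectors-Unique (subsets-Unique k) k)

∈-acyclicOrientations⁻ : ∀ (H : Graph k) {σ} → σ ∈ˡ acyclicOrientations H → IsOrientation H σ × Acyclic σ
∈-acyclicOrientations⁻ {k} H σ∈ =
  proj₂ (∈-filter⁻ (λ σ → isOrientation? H σ ×-dec acyclic? σ) {xs = vectors (subsets k) k} σ∈)

sum-strict : ∀ (H : Graph k) {C : Pred (Fin k) 0ℓ} (C? : Decidable₁ C) y (c : Coloring x k) →
  sumℤ (acyclicOrientations H) (λ σ → ⟦ Steps.strict? (arc? σ) C? y c ⟧) ≡ ⟦ properAbove? H C? y c ⟧
sum-strict H {C} C? y c = ⟦⟧-case (properAbove? H C? y c) one none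
  where
  strictFor? : ∀ σ → Dec _
  strictFor? σ = Steps.strict? (arc? σ) C? y c
  one : ProperAbove H C? y c → sumℤ (acyclicOrientations H) (λ σ → ⟦ strictFor? σ ⟧) ≡ 1ℤ
  one (proper , above) = trans
    (sum-single (acyclicOrientations-Unique H) (ascents∈acyclicOrientations H c proper) λ σ σ∈ σ≢ →
      ⟦⟧-false (strictFor? σ) λ (increasing , _) →
        σ≢ (ascents-unique H c (proj₁ (∈-acyclicOrientations⁻ H σ∈)) increasing))
    (⟦⟧-true (strictFor? (ascents H c)) ((λ v w → proj₂ ∘ ascents-Arc⁻ H c) , above))
  distinct : ∀ {σ} → IsOrientation H σ →
    (∀ v w → Arc σ v w → toℕ (lookupᵛ c v) < toℕ (lookupᵛ c w)) →
    ∀ v w → Adj H v w → color c v ≢ color c w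
  distinct (_ , total) increasing v w vw eq with total v w vw
  ... | inj₁ (arc , _) = ℕₚ.<⇒≢ (increasing v w arc) (ℕₚ.suc-injective eq)
  ... | inj₂ (arc , _) = ℕₚ.<⇒≢ (increasing w v arc) (ℕₚ.suc-injective (sym eq))
  none : ¬ ProperAbove H C? y c → sumℤ (acyclicOrientations H) (λ σ → ⟦ strictFor? σ ⟧) ≡ 0ℤ
  none ¬proper = sum-zero (acyclicOrientations H) λ σ σ∈ →
    ⟦⟧-false (strictFor? σ) λ (increasing , above) →
      ¬proper (distinct {σ} (proj₁ (∈-acyclicOrientations⁻ H σ∈)) increasing , above)

-- Admissible colorings and flats

∈-sublists⁻ : ∀ (xs : List A) {ys a} → ys ∈ˡ sublists xs → a ∈ˡ ys → a ∈ˡ xs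
∈-sublists⁻ []       (here refl) ()
∈-sublists⁻ (x ∷ xs) ys∈ a∈ with ∈-++⁻ (map (x ∷_) (sublists xs)) ys∈
... | inj₂ ys∈′ = there (∈-sublists⁻ xs ys∈′ a∈)
... | inj₁ ys∈′ with ∈-map⁻ (x ∷_) ys∈′
...   | zs , zs∈ , refl with a∈
...     | here refl = here refl
...     | there a∈′ = there (∈-sublists⁻ xs zs∈ a∈′)

sublists-Unique : {xs : List A} → Unique xs → Unique (sublists xs)
sublists-Unique {xs = []}     uniq        = [] ∷ []
sublists-Unique {xs = x ∷ xs} (x∉ ∷ uniq) =
  ++⁺ (map⁺ ∷-injectiveʳ (sublists-Unique uniq)) (sublists-Unique uniq) disjoint
  where
  disjoint : ∀ {ys} → ys ∈ˡ map (x ∷_) (sublists xs) × ys ∈ˡ sublists xs → _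
  disjoint (with-x , without-x) with ∈-map⁻ (x ∷_) with-x
  ... | _ , _ , refl = Unique[x∷xs]⇒x∉xs (x∉ ∷ uniq) (∈-sublists⁻ xs without-x (here refl))

module _ {P : Pred A 0ℓ} (P? : Decidable₁ P) where

  filter∈sublists : ∀ xs → filter P? xs ∈ˡ sublists xs
  filter∈sublists []       = here refl
  filter∈sublists (x ∷ xs) with P? x
  ... | yes _ = ∈-++⁺ˡ (∈-map⁺ (x ∷_) (filter∈sublists xs))
  ... | no _  = ∈-++⁺ʳ (map (x ∷_) (sublists xs)) (filter∈sublists xs)

  -- A sublist of a repetition-free list is determined by its set of elements. This turns an
  -- equality of partitions into an equality of the lists that encode them.
  sublist≡filter : ∀ {xs ys} → Unique xs → ys ∈ˡ sublists xs →
    (∀ {a} → a ∈ˡ ys → P a) → (∀ {a} → a ∈ˡ xs → P a → a ∈ˡ ys) → ys ≡ filter P? xs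
  sublist≡filter {[]}     uniq (here refl) sound complete = refl
  sublist≡filter {x ∷ xs} (x∉ ∷ uniq) ys∈ sound complete with ∈-++⁻ (map (x ∷_) (sublists xs)) ys∈
  ... | inj₂ ys∈′ = trans (sublist≡filter uniq ys∈′ sound (complete ∘ there))
    (sym (filter-reject P? λ Px →
      Unique[x∷xs]⇒x∉xs (x∉ ∷ uniq) (∈-sublists⁻ xs ys∈′ (complete (here refl) Px))))
  ... | inj₁ ys∈′ with ∈-map⁻ (x ∷_) ys∈′
  ...   | zs , zs∈ , refl = trans
    (cong (x ∷_) (sublist≡filter uniq zs∈ (sound ∘ there) complete′))
    (sym (filter-accept P? (sound (here refl))))
    where
    complete′ : ∀ {a} → a ∈ˡ xs → P a → a ∈ˡ zs
    complete′ a∈ Pa with complete (there a∈) Pa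
    ... | here refl = contradiction a∈ (Unique[x∷xs]⇒x∉xs (x∉ ∷ uniq))
    ... | there a∈′ = a∈′

lookup-injective : {xs : List A} → Unique xs → ∀ i j → lookup xs i ≡ lookup xs j → i ≡ j
lookup-injective {xs = _ ∷ _} _ zero    zero    _  = refl
lookup-injective {xs = _ ∷ xs} (x∉ ∷ _) zero (suc j) eq = contradiction eq (All.lookup x∉ (∈-lookup j))
lookup-injective {xs = _ ∷ xs} (x∉ ∷ _) (suc i) zero eq = contradiction (sym eq) (All.lookup x∉ (∈-lookup i))
lookup-injective {xs = _ ∷ _} (_ ∷ uniq) (suc i) (suc j) eq = cong suc (lookup-injective uniq i j eq)

2≤∣p∣⁺ : ∀ {B : Subset n} {v w} → v ∈ B → w ∈ B → v ≢ w → 2 ≤ ∣ B ∣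
2≤∣p∣⁺ {B = B} {v} {w} v∈ w∈ v≢w = subst (_< ∣ B ∣) (∣⁅x⁆∣≡1 v)
  (p⊂q⇒∣p∣<∣q∣ ((λ u∈ → subst (_∈ B) (sym (x∈⁅y⁆⇒x≡y v u∈)) v∈) ,
    w , w∈ , λ w∈⁅v⁆ → v≢w (sym (x∈⁅y⁆⇒x≡y v w∈⁅v⁆))))

2≤∣p∣⁻ : ∀ {B : Subset n} → 2 ≤ ∣ B ∣ → ∀ v → ∃ λ w → w ∈ B × w ≢ v
2≤∣p∣⁻ {B = B} 2≤ v with any? (λ w → (w ∈? B) ×-dec ¬? (w ≟ v))
... | yes found = found
... | no none   = contradiction (subst (∣ B ∣ ≤_) (∣⁅x⁆∣≡1 v) (p⊆q⇒∣p∣≤∣q∣ B⊆⁅v⁆)) (ℕₚ.<⇒≱ 2≤)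
  where
  B⊆⁅v⁆ : ∀ {w} → w ∈ B → w ∈ ⁅ v ⁆
  B⊆⁅v⁆ {w} w∈ with w ≟ v
  ... | yes refl = x∈⁅x⁆ v
  ... | no w≢v   = contradiction (w , w∈ , w≢v) none

color-injective : ∀ (c : Coloring x n) (d : Coloring x k) {v i} →
  color c v ≡ color d i → lookupᵛ c v ≡ lookupᵛ d i
color-injective c d eq = toℕ-injective (ℕₚ.suc-injective eq)

-- For a partition this says that `c` is the pullback of `d` along the contraction map. As a
-- relation it can be summed over either coloring.
Fits : (Bs : List (Subset n)) → Coloring x n → Coloring x (length Bs) → Set
Fits Bs c d = ∀ v i → v ∈ lookup Bs i → lookupᵛ c v ≡ lookupᵛ d i

fits? : (Bs : List (Subset n)) (c : Coloring x n) (d : Coloring x (length Bs)) → Dec (Fits Bs c d)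
fits? Bs c d = all? λ v → all? λ i → (v ∈? lookup Bs i) →-dec (lookupᵛ c v ≟ lookupᵛ d i)

fits-count : ∀ (Bs : List (Subset n)) → IsPartition Bs → (d : Coloring x (length Bs)) →
  sumℤ (colorings x n) (λ c → ⟦ fits? Bs c d ⟧) ≡ 1ℤ
fits-count {n} {x} Bs (_ , cover) d = trans
  (sum-single (colorings-Unique x n) (∈-colorings c₀) λ c _ c≢c₀ →
    ⟦⟧-false (fits? Bs c d) λ fits → c≢c₀ (lookup-ext λ v →
      trans (fits v (block v) (∈-block v)) (sym (lookup∘tabulate (lookupᵛ d ∘ block) v))))
  (⟦⟧-true (fits? Bs c₀ d) λ v i v∈ →
    trans (lookup∘tabulate (lookupᵛ d ∘ block) v) (cong (lookupᵛ d) (proj₂ (proj₂ (cover v)) v∈)))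
  where
  block : Fin n → Fin (length Bs)
  block v = proj₁ (cover v)
  ∈-block : ∀ v → v ∈ lookup Bs (block v)
  ∈-block v = proj₁ (proj₂ (cover v))
  c₀ : Coloring x n
  c₀ = tabulate (lookupᵛ d ∘ block)

module _ (G : Graph n) {x : ℕ} (c : Coloring x n) where

  Mono : Rel (Fin n) 0ℓ
  Mono u v = Adj G u v × lookupᵛ c u ≡ lookupᵛ c v

  mono? : Decidable Mono
  mono? u v = adj? G u v ×-dec (lookupᵛ c u ≟ lookupᵛ c v)

  Mono-sym : ∀ {u v} → Star Mono u v → Star Mono v u
  Mono-sym = reverse λ (uv , eq) → symm G uv , sym eq

  Mono-color : ∀ {u v} → Star Mono u v → lookupᵛ c u ≡ lookupᵛ c v
  Mono-color ε              = refl
  Mono-color ((_ , eq) ◅ s) = trans eq (Mono-color s)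

  component : Fin n → Subset n
  component v = comprehension (star? mono? v)

  component-≡ : ∀ {u v} → Star Mono u v → component u ≡ component v
  component-≡ {u} {v} uv = ⊆-antisym
    (λ w∈ → ∈-comprehension⁺ (star? mono? v) (Mono-sym uv ◅◅ ∈-comprehension⁻ (star? mono? u) w∈))
    (λ w∈ → ∈-comprehension⁺ (star? mono? u) (uv ◅◅ ∈-comprehension⁻ (star? mono? v) w∈))

  ∈-component⁻ : ∀ {u v} → v ∈ component u → Star Mono u v
  ∈-component⁻ {u} = ∈-comprehension⁻ (star? mono? u)

  ∈-component : ∀ v → v ∈ component v
  ∈-component v = ∈-comprehension⁺ (star? mono? v) ε

  IsComponent : Subset n → Set
  IsComponent B = ∃ λ v → B ≡ component v

  isComponent? : Decidable₁ IsComponent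
  isComponent? B = any? λ v → ≡-dec Bool._≟_ B (component v)

  components : List (Subset n)
  components = filter isComponent? (subsets n)

  module _ (y : ℕ) where

    -- The flat is recovered from `c`: properness of `d` forbids monochromatic edges between
    -- distinct blocks, and the edges inside a block are monochromatic since `c` is constant there.
    -- As blocks are connected, they are the components of the monochromatic edges.
    module FromFlat {Bs : List (Subset n)} (flat : IsFlat G Bs) (d : Coloring x (length Bs))
                    (above : ProperAbove (flatGraph G Bs) (contracted? Bs) y d)
                    (fits : Fits Bs c d) where

      block : Fin n → Fin (length Bs)
      block v = proj₁ (proj₂ (proj₁ flat) v)

      ∈-block : ∀ v → v ∈ lookup Bs (block v)
      ∈-block v = proj₁ (proj₂ (proj₂ (proj₁ flat) v))

      same-block : ∀ {v w i j} → Adj G v w → v ∈ lookup Bs i → w ∈ lookup Bs j →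
        lookupᵛ c v ≡ lookupᵛ c w → i ≡ j
      same-block {v} {w} {i} {j} vw v∈ w∈ eq with i ≟ j
      ... | yes i≡j = i≡j
      ... | no i≢j  = contradiction
        (cong (suc ∘ toℕ) (trans (sym (fits v i v∈)) (trans eq (fits w j w∈))))
        (proj₁ above i j (i≢j , v , w , v∈ , w∈ , vw))

      admissible : Admissible G x y c
      admissible v w vw with color c v ≟ℕ color c w
      ... | no ne  = inj₁ ne
      -- Both ends of a monochromatic edge lie in one block, and they are distinct, so the block is
      -- contracted and its color exceeds `y`.
      ... | yes eq = inj₂ (eq , subst (λ a → y < suc (toℕ a)) (sym (fits v (block v) (∈-block v)))
        (proj₂ above (block v) (2≤∣p∣⁺ (∈-block v) w∈ λ v≡w → irrefl G v≡w vw)))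
        where
        w∈ : w ∈ lookup Bs (block v)
        w∈ = subst (λ i → w ∈ lookup Bs i)
          (sym (same-block vw (∈-block v) (∈-block w) (color-injective c c eq))) (∈-block w)

      stays : ∀ {v w i} → v ∈ lookup Bs i → Star Mono v w → w ∈ lookup Bs i
      stays v∈ ε = v∈
      stays {i = i} v∈ (_◅_ {j = u} (vu , eq) s) = stays
        (subst (λ j → u ∈ lookup Bs j) (sym (same-block vu v∈ (∈-block u) eq)) (∈-block u)) s

      within⇒Mono : ∀ {v w i} → Star (AdjWithin G (lookup Bs i)) v w → Star Mono v w
      within⇒Mono ε = ε
      within⇒Mono {i = i} ((v∈ , u∈ , vu) ◅ s) =
        (vu , trans (fits _ i v∈) (sym (fits _ i u∈))) ◅ within⇒Mono {i = i} s

      block-component : ∀ {v i} → v ∈ lookup Bs i → lookup Bs i ≡ component v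
      block-component {v} {i} v∈ = ⊆-antisym
        (λ {w} w∈ → ∈-comprehension⁺ (star? mono? v)
          (within⇒Mono {i = i} (All.lookup (proj₂ flat) (∈-lookup i) v w v∈ w∈)))
        (λ w∈ → stays v∈ (∈-component⁻ w∈))

      blocks≡components : Bs ∈ˡ sublists (subsets n) → Bs ≡ components
      blocks≡components Bs∈ = sublist≡filter isComponent? (subsets-Unique n) Bs∈ sound complete
        where
        sound : ∀ {B} → B ∈ˡ Bs → IsComponent B
        sound B∈ with All.lookup (proj₁ (proj₁ flat)) B∈
        ... | v , v∈ = v , trans (lookup-index B∈)
          (block-component (subst (v ∈_) (lookup-index B∈) v∈))
        complete : ∀ {B} → B ∈ˡ subsets n → IsComponent B → B ∈ˡ Bs
        complete _ (v , refl) =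
          subst (_∈ˡ Bs) (block-component (∈-block v)) (∈-lookup (block v))

    component∈components : ∀ v → component v ∈ˡ components
    component∈components v = ∈-filter⁺ isComponent? (∈-subsets (component v)) (v , refl)

    blockOf : Fin n → Fin (length components)
    blockOf v = index (component∈components v)

    lookup-blockOf : ∀ v → lookup components (blockOf v) ≡ component v
    lookup-blockOf v = sym (lookup-index (component∈components v))

    components-sound : ∀ {B} → B ∈ˡ components → IsComponent B
    components-sound B∈ = proj₂ (∈-filter⁻ isComponent? {xs = subsets n} B∈)

    root : Fin (length components) → Fin n
    root i = proj₁ (components-sound (∈-lookup i))

    lookup-root : ∀ i → lookup components i ≡ component (root i)
    lookup-root i = proj₂ (components-sound (∈-lookup i))

    root-connected : ∀ {v i} → v ∈ lookup components i → Star Mono (root i) v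
    root-connected {v} {i} v∈ = ∈-component⁻ (subst (v ∈_) (lookup-root i) v∈)

    -- The walk from the base vertex `u` is extended along the way; it certifies that each vertex
    -- visited lies in the component of `u`.
    Mono-within : ∀ {u v w} → Star Mono u v → Star Mono v w → Star (AdjWithin G (component u)) v w
    Mono-within uv ε = ε
    Mono-within {u} uv (vz ◅ s) =
      (∈-comprehension⁺ (star? mono? u) uv , ∈-comprehension⁺ (star? mono? u) uz , proj₁ vz) ◅
      Mono-within uz s
      where uz = uv ◅◅ (vz ◅ ε)

    components-flat : IsFlat G components
    components-flat = (All.tabulate nonempty , cover) , All.tabulate connected
      where
      nonempty : ∀ {B} → B ∈ˡ components → Nonempty B
      nonempty B∈ with components-sound B∈
      ... | v , refl = v , ∈-component v
      connected : ∀ {B} → B ∈ˡ components → Connected G B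
      connected B∈ v w v∈ w∈ with components-sound B∈
      ... | u , refl = Mono-within (∈-component⁻ v∈) (Mono-sym (∈-component⁻ v∈) ◅◅ ∈-component⁻ w∈)
      cover : ∀ v → _
      cover v = blockOf v , subst (v ∈_) (sym (lookup-blockOf v)) (∈-component v) , λ {i} v∈ →
        lookup-injective (filter⁺ isComponent? (subsets-Unique n)) (blockOf v) i
          (trans (lookup-blockOf v) (trans (sym (component-≡ (root-connected v∈))) (sym (lookup-root i))))

    componentColoring : Coloring x (length components)
    componentColoring = tabulate (lookupᵛ c ∘ root)

    component-fits : Fits components c componentColoring
    component-fits v i v∈ = trans (sym (Mono-color (root-connected v∈)))
      (sym (lookup∘tabulate (lookupᵛ c ∘ root) i))

    component-fits-unique : ∀ {d} → Fits components c d → d ≡ componentColoring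
    component-fits-unique {d} fits = lookup-ext λ i → trans
      (sym (fits (root i) i (subst (root i ∈_) (sym (lookup-root i)) (∈-component (root i)))))
      (sym (lookup∘tabulate (lookupᵛ c ∘ root) i))

    -- An edge between two components of equal color would be monochromatic and would have merged
    -- them. A component with a vertex other than its root has a monochromatic edge at the root, and
    -- there admissibility forces the color above `y`.
    component-properAbove : Admissible G x y c →
      ProperAbove (flatGraph G components) (contracted? components) y componentColoring
    component-properAbove adm = proper , above
      where
      proper : ∀ i j → Adj (flatGraph G components) i j →
        color componentColoring i ≢ color componentColoring j
      proper i j (i≢j , v , w , v∈ , w∈ , vw) eq = i≢j
        (lookup-injective (filter⁺ isComponent? (subsets-Unique n)) i j
          (trans (lookup-root i) (trans (component-≡ i~j) (sym (lookup-root j)))))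
        where
        i~j : Star Mono (root i) (root j)
        i~j = root-connected v∈ ◅◅ ((vw , trans (component-fits v i v∈)
          (trans (color-injective componentColoring componentColoring eq) (sym (component-fits w j w∈)))) ◅
          Mono-sym (root-connected w∈))
      first-step : ∀ {v w} → v ≢ w → Star Mono v w → y < color c v
      first-step v≢v ε = contradiction refl v≢v
      first-step _ ((vu , eq) ◅ _) with adm _ _ vu
      ... | inj₁ ne       = contradiction (cong (suc ∘ toℕ) eq) ne
      ... | inj₂ (_ , lt) = lt
      above : ∀ i → Contracted components i → y < color componentColoring i
      above i 2≤ with 2≤∣p∣⁻ 2≤ (root i)
      ... | w , w∈ , w≢root = subst (λ a → y < suc (toℕ a)) (sym (lookup∘tabulate (lookupᵛ c ∘ root) i))
        (first-step (≢-sym w≢root) (root-connected w∈))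

flats-Unique : (G : Graph n) → Unique (flats G)
flats-Unique {n} G = filter⁺ (isFlat? G) (sublists-Unique (subsets-Unique n))

∈-flats⁻ : ∀ (G : Graph n) {Bs} → Bs ∈ˡ flats G → Bs ∈ˡ sublists (subsets n) × IsFlat G Bs
∈-flats⁻ {n} G = ∈-filter⁻ (isFlat? G) {xs = sublists (subsets n)}

-- Admissible colorings counted over the flats

module _ (G : Graph n) (x y : ℕ) where

  flatProper? : (Bs : List (Subset n)) (d : Coloring x (length Bs)) →
    Dec (ProperAbove (flatGraph G Bs) (contracted? Bs) y d)
  flatProper? Bs = properAbove? (flatGraph G Bs) (contracted? Bs) y

  term : (Bs : List (Subset n)) → Coloring x n → Coloring x (length Bs) → ℤ
  term Bs c d = ⟦ flatProper? Bs d ⟧ * ⟦ fits? Bs c d ⟧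

  sum-term : ∀ c → sumℤ (flats G) (λ Bs → sumℤ (colorings x (length Bs)) (term Bs c)) ≡
    ⟦ admissible? G x y c ⟧
  sum-term c = ⟦⟧-case (admissible? G x y c) one none
    where
    Bs₀ = components G c
    d₀  = componentColoring G c y
    one : Admissible G x y c → sumℤ (flats G) (λ Bs → sumℤ (colorings x (length Bs)) (term Bs c)) ≡ 1ℤ
    one adm = begin
      sumℤ (flats G) (λ Bs → sumℤ (colorings x (length Bs)) (term Bs c))
        ≡⟨ sum-single (flats-Unique G)
             (∈-filter⁺ (isFlat? G) (filter∈sublists (isComponent? G c) (subsets n)) (components-flat G c y))
             (λ Bs Bs∈ Bs≢ → sum-zero (colorings x (length Bs)) λ d _ →
               ⟦⟧-vanish (flatProper? Bs d) ⟦ fits? Bs c d ⟧ λ above →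
               ⟦⟧-false (fits? Bs c d) λ fits → let Bs∈′ , flat = ∈-flats⁻ G Bs∈ in
               Bs≢ (FromFlat.blocks≡components G c y flat d above fits Bs∈′)) ⟩
      sumℤ (colorings x (length Bs₀)) (term Bs₀ c)
        ≡⟨ sum-single (colorings-Unique x (length Bs₀)) (∈-colorings d₀) (λ d _ d≢ →
             ⟦⟧-vanish (flatProper? Bs₀ d) ⟦ fits? Bs₀ c d ⟧ λ _ →
             ⟦⟧-false (fits? Bs₀ c d) λ fits → d≢ (component-fits-unique G c y fits)) ⟩
      term Bs₀ c d₀
        ≡⟨ cong₂ _*_ (⟦⟧-true (flatProper? Bs₀ d₀) (component-properAbove G c y adm))
                     (⟦⟧-true (fits? Bs₀ c d₀) (component-fits G c y)) ⟩
      1ℤ ∎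
      where open ≡-Reasoning
    none : ¬ Admissible G x y c → sumℤ (flats G) (λ Bs → sumℤ (colorings x (length Bs)) (term Bs c)) ≡ 0ℤ
    none ¬adm = sum-zero (flats G) λ Bs Bs∈ → sum-zero (colorings x (length Bs)) λ d _ →
      ⟦⟧-vanish (flatProper? Bs d) ⟦ fits? Bs c d ⟧ λ above →
      ⟦⟧-false (fits? Bs c d) λ fits →
        ¬adm (FromFlat.admissible G c y (proj₂ (∈-flats⁻ G Bs∈)) d above fits)

  -- Double counting of the fitting pairs of colorings over all flats. For a fixed flat and proper
  -- `d` exactly one `c` fits; for a fixed `c` there is one flat with one `d` if `c` is admissible,
  -- and none otherwise.
  sum-flats : sumℤ (flats G) (λ Bs → sumℤ (colorings x (length Bs)) (λ d → ⟦ flatProper? Bs d ⟧)) ≡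
    + countAdmissible G x y
  sum-flats = begin
    sumℤ (flats G) (λ Bs → sumℤ (colorings x (length Bs)) (λ d → ⟦ flatProper? Bs d ⟧))
      ≡⟨ sum-cong (flats G) (λ Bs Bs∈ → sum-cong (colorings x (length Bs)) λ d _ → expand Bs Bs∈ d) ⟩
    sumℤ (flats G) (λ Bs → sumℤ (colorings x (length Bs)) (λ d → sumℤ (colorings x n) (λ c → term Bs c d)))
      ≡⟨ sum-cong (flats G) (λ Bs _ →
           sum-swap (colorings x (length Bs)) (colorings x n) (λ d c → term Bs c d)) ⟩
    sumℤ (flats G) (λ Bs → sumℤ (colorings x n) (λ c → sumℤ (colorings x (length Bs)) (term Bs c)))
      ≡⟨ sum-swap (flats G) (colorings x n) (λ Bs c → sumℤ (colorings x (length Bs)) (term Bs c)) ⟩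
    sumℤ (colorings x n) (λ c → sumℤ (flats G) (λ Bs → sumℤ (colorings x (length Bs)) (term Bs c)))
      ≡⟨ sum-cong (colorings x n) (λ c _ → sum-term c) ⟩
    sumℤ (colorings x n) (λ c → ⟦ admissible? G x y c ⟧)
      ≡⟨ sym (count-sum (admissible? G x y) (colorings x n)) ⟩
    + countAdmissible G x y ∎
    where
    open ≡-Reasoning
    expand : ∀ Bs → Bs ∈ˡ flats G → ∀ d →
      ⟦ flatProper? Bs d ⟧ ≡ sumℤ (colorings x n) (λ c → term Bs c d)
    expand Bs Bs∈ d = begin
      ⟦ flatProper? Bs d ⟧       ≡⟨ sym (*-identityʳ ⟦ flatProper? Bs d ⟧) ⟩
      ⟦ flatProper? Bs d ⟧ * 1ℤ
        ≡⟨ cong (⟦ flatProper? Bs d ⟧ *_) (sym (fits-count Bs (proj₁ (proj₂ (∈-flats⁻ G Bs∈))) d)) ⟩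
      ⟦ flatProper? Bs d ⟧ * sumℤ (colorings x n) (λ c → ⟦ fits? Bs c d ⟧)
        ≡⟨ sym (sum-*ˡ (colorings x n) ⟦ flatProper? Bs d ⟧ _) ⟩
      sumℤ (colorings x n) (λ c → term Bs c d) ∎

-- The reciprocity theorem

module _ {n : ℕ} (G : Graph n) where

  flatOrderPolynomial : (Bs : List (Subset n)) → Orientation (length Bs) → ℤ → ℤ → ℤ
  flatOrderPolynomial Bs σ = Steps.orderPolynomial (arc? σ) (contracted? Bs)

  -- One function carries both sides of the theorem: at `y` and `x ∸ y` it counts the admissible
  -- colorings of `G`, and at their negatives it is the signed sum over the flats.
  reciprocal : ℤ → ℤ → ℤ
  reciprocal y z = sumℤ (flats G) λ Bs →
    sumℤ (acyclicOrientations (flatGraph G Bs)) λ σ → flatOrderPolynomial Bs σ y z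

  acyclic : ∀ Bs {σ} → σ ∈ˡ acyclicOrientations (flatGraph G Bs) → Acyclic σ
  acyclic Bs σ∈ = proj₂ (∈-acyclicOrientations⁻ (flatGraph G Bs) σ∈)

  reciprocal-Polyˡ : ∀ z → Poly (λ y → reciprocal y z)
  reciprocal-Polyˡ z = Poly-sum (flats G) λ Bs _ → Poly-sum (acyclicOrientations (flatGraph G Bs))
    λ σ σ∈ → Steps.orderPolynomial-Polyˡ (arc? σ) (contracted? Bs) (acyclic Bs σ∈) z

  reciprocal-Polyʳ : ∀ y → Poly (λ z → reciprocal y z)
  reciprocal-Polyʳ y = Poly-sum (flats G) λ Bs _ → Poly-sum (acyclicOrientations (flatGraph G Bs))
    λ σ σ∈ → Steps.orderPolynomial-Polyʳ (arc? σ) (contracted? Bs) (acyclic Bs σ∈) y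

  module _ {x y : ℕ} (y≤x : y ≤ x) where

    reciprocal-pos : reciprocal (+ y) (+ (x ∸ y)) ≡ + countAdmissible G x y
    reciprocal-pos = trans (sum-cong (flats G) flat) (sum-flats G x y)
      where
      open ≡-Reasoning
      flat : ∀ Bs → Bs ∈ˡ flats G →
        sumℤ (acyclicOrientations (flatGraph G Bs)) (λ σ → flatOrderPolynomial Bs σ (+ y) (+ (x ∸ y))) ≡
        sumℤ (colorings x (length Bs)) (λ d → ⟦ flatProper? G x y Bs d ⟧)
      flat Bs _ = begin
        sumℤ orientations (λ σ → flatOrderPolynomial Bs σ (+ y) (+ (x ∸ y)))
          ≡⟨ sum-cong orientations (λ σ σ∈ →
               Steps.orderPolynomial-strict (arc? σ) (contracted? Bs) (acyclic Bs σ∈) y≤x) ⟩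
        sumℤ orientations (λ σ → sumℤ (colorings x (length Bs)) (strictly σ))
          ≡⟨ sum-swap orientations (colorings x (length Bs)) strictly ⟩
        sumℤ (colorings x (length Bs)) (λ d → sumℤ orientations (λ σ → strictly σ d))
          ≡⟨ sum-cong (colorings x (length Bs)) (λ d _ →
               sum-strict (flatGraph G Bs) (contracted? Bs) y d) ⟩
        sumℤ (colorings x (length Bs)) (λ d → ⟦ flatProper? G x y Bs d ⟧) ∎
        where
        orientations = acyclicOrientations (flatGraph G Bs)
        strictly : Orientation (length Bs) → Coloring x (length Bs) → ℤ
        strictly σ d = ⟦ Steps.strict? (arc? σ) (contracted? Bs) y d ⟧

    reciprocal-neg : reciprocal (- (+ y)) (- (+ (x ∸ y))) ≡
      sumℤ (flats G) (λ H → (-1ℤ ^ length H) * + m G x y H)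
    reciprocal-neg = sum-cong (flats G) flat
      where
      open ≡-Reasoning
      flat : ∀ Bs → Bs ∈ˡ flats G →
        sumℤ (acyclicOrientations (flatGraph G Bs))
          (λ σ → flatOrderPolynomial Bs σ (- (+ y)) (- (+ (x ∸ y)))) ≡
        (-1ℤ ^ length Bs) * + m G x y Bs
      flat Bs _ = begin
        sumℤ orientations (λ σ → flatOrderPolynomial Bs σ (- (+ y)) (- (+ (x ∸ y))))
          ≡⟨ sum-cong orientations (λ σ σ∈ →
               Steps.orderPolynomial-weak (arc? σ) (contracted? Bs) (acyclic Bs σ∈) y≤x) ⟩
        sumℤ orientations (λ σ → -1ℤ ^ length Bs * sumℤ (colorings x (length Bs)) (weakly σ))
          ≡⟨ sum-*ˡ orientations (-1ℤ ^ length Bs) _ ⟩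
        -1ℤ ^ length Bs * sumℤ orientations (λ σ → sumℤ (colorings x (length Bs)) (weakly σ))
          ≡⟨ cong (-1ℤ ^ length Bs *_) (sum-cong orientations λ σ _ →
               sum-cong (colorings x (length Bs)) λ d _ → weakly≡valid σ d) ⟩
        -1ℤ ^ length Bs * sumℤ orientations (λ σ → sumℤ (colorings x (length Bs)) λ d →
          ⟦ validPair? y Bs (σ , d) ⟧)
          ≡⟨ cong (-1ℤ ^ length Bs *_) (sym (trans
               (count-sum (validPair? y Bs) (cartesianProduct orientations (colorings x (length Bs))))
               (sum-cartesianProductWith _,_ orientations (colorings x (length Bs)) _))) ⟩
        -1ℤ ^ length Bs * + m G x y Bs ∎
        where
        orientations = acyclicOrientations (flatGraph G Bs)
        weakly : Orientation (length Bs) → Coloring x (length Bs) → ℤ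
        weakly σ d = ⟦ Steps.weak? (arc? σ) (contracted? Bs) y d ⟧
        weakly≡valid : ∀ σ d → weakly σ d ≡ ⟦ validPair? y Bs (σ , d) ⟧
        weakly≡valid σ d = ⟦⟧-cong (Steps.weak? (arc? σ) (contracted? Bs) y d) (validPair? y Bs (σ , d))
          (λ (arcs , above) → (λ v w vw → s≤s (arcs v w vw)) , above)
          (λ (arcs , above) → (λ v w vw → ℕₚ.≤-pred (arcs v w vw)) , above)

  -- Both sides are polynomial functions of y and of z agreeing at positive integers.
  chromatic≡reciprocal : (χ : BivariateChromaticPolynomial G) → ∀ y z → χ ⟨ y + z , y ⟩ ≡ reciprocal y z
  chromatic≡reciprocal χ y z = Poly-unique (eval₂-Polyˡ (polynomial χ) z) (reciprocal-Polyˡ z)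
    (λ a → Poly-unique (eval₂-Polyʳ (polynomial χ) (+ suc a)) (reciprocal-Polyʳ (+ suc a))
      (λ b → agree (suc a) (suc b) (s≤s z≤n)) z) y
    where
    agree : ∀ a b → 1 ≤ a → χ ⟨ + a + + b , + a ⟩ ≡ reciprocal (+ a) (+ b)
    agree a b 1≤a = begin
      χ ⟨ + (a +ℕ b) , + a ⟩              ≡⟨ counts χ (a +ℕ b) a (ℕₚ.≤-trans 1≤a (ℕₚ.m≤m+n a b)) (ℕₚ.m≤m+n a b) ⟩
      + countAdmissible G (a +ℕ b) a      ≡⟨ sym (reciprocal-pos (ℕₚ.m≤m+n a b)) ⟩
      reciprocal (+ a) (+ (a +ℕ b ∸ a))   ≡⟨ cong (λ c → reciprocal (+ a) (+ c)) (ℕₚ.m+n∸m≡n a b) ⟩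
      reciprocal (+ a) (+ b)              ∎
      where open ≡-Reasoning

theorem2 : ∀ {n : ℕ} (G : Graph n) (χ : BivariateChromaticPolynomial G) (x y : ℕ) → 1 ≤ x → y ≤ x →
    χ ⟨ - (+ x) , - (+ y) ⟩ ≡ sumℤ (flats G) (λ H → (-1ℤ ^ length H) * + m G x y H)
theorem2 G χ x y 1≤x y≤x = begin
  χ ⟨ - (+ x) , - (+ y) ⟩
    ≡⟨ cong (λ a → χ ⟨ a , - (+ y) ⟩) (trans (cong (λ a → - (+ a)) (sym (ℕₚ.m+[n∸m]≡n y≤x)))
         (neg-distrib-+ (+ y) (+ (x ∸ y)))) ⟩
  χ ⟨ - (+ y) + - (+ (x ∸ y)) , - (+ y) ⟩
    ≡⟨ chromatic≡reciprocal G χ (- (+ y)) (- (+ (x ∸ y))) ⟩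
  reciprocal G (- (+ y)) (- (+ (x ∸ y)))
    ≡⟨ reciprocal-neg G y≤x ⟩
  sumℤ (flats G) (λ H → (-1ℤ ^ length H) * + m G x y H) ∎
  where open ≡-Reasoning
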